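{- Let $p_1$ be an odd prime, $m\ge 1$ an integer and $N=p_1^m$. Let $p$ be a prime with $\gcd(p(p-1),N)=1$, let $f=\mathrm{ord}_N(p)$ be the multiplicative order of $p$ modulo $N$, let $q=p^f$, and let $w=[(\mathbb{Z}/N\mathbb{Z})^*:\langle p\rangle]=\phi(N)/f$. Assume that $-1\notin\langle p\rangle$ in $(\mathbb{Z}/N\mathbb{Z})^*$ and that $w\mid (p_1-1)$. Let $\gamma$ be a fixed primitive element of $\mathbb{F}_q$, let $C_i=\{\gamma^{i+jN}\mid 0\le j\le \frac{q-1}{N}-1\}$ for $0\le i\le N-1$, and let $$D=\bigcup_{i=0}^{p_1^{m-1}-1} C_i .$$ Then the Cayley graph $\mathrm{Cay}(\mathbb{F}_q,D)$ is an undirected regular graph of valency $|D|$, and it has at most $w+1$ distinct restricted eigenvalues.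
   Context: $\phi$ denotes the Euler totient function and $\langle p\rangle$ denotes the cyclic subgroup of $(\mathbb{Z}/N\mathbb{Z})^*$ generated by $p$. For a subset $D\subseteq\mathbb{F}_q^*$, $\mathrm{Cay}(\mathbb{F}_q,D)$ is the graph with vertex set $\mathbb{F}_q$ in which two vertices are adjacent if and only if their difference belongs to $D$ (it is undirected when $-D=D$). The eigenvalues of a graph are the eigenvalues of its adjacency matrix; an eigenvalue is called restricted if it has an eigenvector orthogonal to the all-one vector. -}

module Defs where

open import Algebra.Apartness.Bundles using (HeytingField)
open import Algebra.Bundles using (CommutativeRing)
import Algebra.Apartness.Properties.HeytingCommutativeRing as HCRProperties
import Algebra.Definitions.RawMonoid as RawMonoidDefs
import Algebra.Properties.CommutativeMonoid.Sum as SumProperties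
import Algebra.Properties.Semiring.Exp as ExpProperties
open import Data.Bool.Base using (if_then_else_)
open import Data.Fin.Base using (Fin; toℕ)
import Data.Fin.Properties as Fin
open import Data.Integer.Base as ℤ using (ℤ; +_)
import Data.Integer.Divisibility as ℤ
open import Data.Nat.Base using (ℕ; zero; suc; _+_; _*_; _∸_; _≤_; _/_; NonZero)
open import Data.Nat.Coprimality using (coprime?)
open import Data.Product.Base using (Σ-syntax; ∃-syntax; _×_; _,_)
open import Data.Vec.Base using (allFin; count; tabulate)
open import Data.Vec.Functional using (Vector)
open import Function.Bundles using (Inverse)
open import Function.Definitions using (Injective)
open import Level using (Level; _⊔_) renaming (suc to lsuc)
open import Relation.Binary.Bundles using (Setoid)
open import Relation.Binary.Core using (Rel)
open import Relation.Binary.Definitions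
  using (Decidable; Irreflexive; Symmetric; _Respects₂_)
open import Relation.Binary.PropositionalEquality as ≡ using (_≡_)
open import Relation.Nullary.Decidable using (does; map′)
open import Relation.Nullary.Negation using (¬_)
open import Relation.Unary using (Pred) renaming (Decidable to Decidable₁)

private
  variable
    a c ℓ ℓ₁ ℓ₂ k ℓ₃ ℓ₄ : Level

------------------------------------------------------------------------
-- Arithmetic modulo N

φ : ℕ → ℕ
φ N = count (λ (i : Fin N) → coprime? (toℕ i) N) (allFin N)

infix 4 _≡_[mod_]

_≡_[mod_] : ℤ → ℤ → ℕ → Set
x ≡ y [mod N ] = (+ N) ℤ.∣ (x ℤ.- y)

-- The multiplicative order of p modulo N is f.
record IsOrder (p N f : ℕ) : Set where
  field
    positive : 1 ≤ f
    power≡1  : (+ p) ℤ.^ f ≡ + 1 [mod N ]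
    minimal  : ∀ g → 1 ≤ g → (+ p) ℤ.^ g ≡ + 1 [mod N ] → f ≤ g

-- Membership of the class of x in the subgroup ⟨p⟩ of (ℤ/Nℤ)*, for p
-- coprime to N. That group is finite, so powers with nonnegative exponent
-- already exhaust ⟨p⟩.
_∈⟨_⟩[mod_] : ℤ → ℕ → ℕ → Set
x ∈⟨ p ⟩[mod N ] = ∃[ e ] x ≡ (+ p) ℤ.^ e [mod N ]

------------------------------------------------------------------------
-- Finite sets and graphs

Enumeration : ℕ → Setoid a ℓ → Set (a ⊔ ℓ)
Enumeration n S = Inverse (≡.setoid (Fin n)) S

module _ {n : ℕ} {S : Setoid a ℓ} (enum : Enumeration n S) where
  open Setoid S
  open Inverse enum

  ≈-dec : Decidable _≈_
  ≈-dec x y = map′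
    (λ eq → trans (sym (strictlyInverseˡ x)) (trans (to-cong eq) (strictlyInverseˡ y)))
    from-cong (from x Fin.≟ from y)

  cardinality : ∀ {p} {P : Pred Carrier p} → Decidable₁ P → ℕ
  cardinality P? = count P? (tabulate to)

-- Finite loopless directed graphs; undirectedness is a separate predicate.
record Graph (c ℓ ℓ₁ : Level) : Set (lsuc (c ⊔ ℓ ⊔ ℓ₁)) where
  infix 4 _~_ _~?_
  field
    vertices : Setoid c ℓ
    order    : ℕ
    enum     : Enumeration order vertices

  open Setoid vertices public using () renaming (Carrier to Vertex; _≈_ to _≈ᵥ_)

  field
    _~_      : Rel Vertex ℓ₁
    _~?_     : Decidable _~_
    ~-resp   : _~_ Respects₂ _≈ᵥ_
    ~-irrefl : Irreflexive _≈ᵥ_ _~_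

Undirected : Graph c ℓ ℓ₁ → Set (c ⊔ ℓ₁)
Undirected G = Symmetric (Graph._~_ G)

Regular : Graph c ℓ ℓ₁ → ℕ → Set c
Regular G d = ∀ x → cardinality enum (x ~?_) ≡ d
  where open Graph G

------------------------------------------------------------------------
-- Eigenvalues
--
-- The eigenvalues are taken in a field K. Classically every field is a
-- Heyting field, with x # y meaning x ≉ y; constructively the real and the
-- complex numbers are Heyting fields, but have no decidable equality.

module _ (K : HeytingField k ℓ₃ ℓ₄) where
  open HeytingField K using (Carrier; _≈_; 0#; 1#)
    renaming (_*_ to _*ᴷ_)
  private
    R = record { isCommutativeRing = HeytingField.isCommutativeRing K }
    module R = CommutativeRing R
  open SumProperties R.+-commutativeMonoid using (sum-syntax)
  open RawMonoidDefs R.+-rawMonoid renaming (_×_ to _·_) using ()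

  CharacteristicZero : Set ℓ₃
  CharacteristicZero = ∀ n → ¬ (suc n · 1# ≈ 0#)

  SquareMatrix : ℕ → Set k
  SquareMatrix n = Fin n → Fin n → Carrier

  dot : ∀ {n} → Vector Carrier n → Vector Carrier n → Carrier
  dot {n} u v = ∑[ i < n ] (u i *ᴷ v i)

  record IsEigenvector {n} (A : SquareMatrix n) (θ : Carrier)
                       (v : Vector Carrier n) : Set (k ⊔ ℓ₃) where
    field
      nonzero : ¬ (∀ i → v i ≈ 0#)
      eigen   : ∀ i → dot (A i) v ≈ θ *ᴷ v i

  -- The vertices are indexed through the enumeration of the graph.
  adjacencyMatrix : (G : Graph c ℓ ℓ₁) → SquareMatrix (Graph.order G)
  adjacencyMatrix G i j = if does (to i ~? to j) then 1# else 0#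
    where
    open Graph G
    open Inverse enum using (to)

  RestrictedEigenvalue : Graph c ℓ ℓ₁ → Carrier → Set (k ⊔ ℓ₃)
  RestrictedEigenvalue G θ =
    ∃[ v ] IsEigenvector (adjacencyMatrix G) θ v × dot (λ _ → 1#) v ≈ 0#

  AtMost : ∀ {p} → ℕ → Pred Carrier p → Set (k ⊔ ℓ₃ ⊔ p)
  AtMost b P = ∀ n (θ : Fin n → Carrier) →
    Injective _≡_ _≈_ θ → (∀ i → P (θ i)) → n ≤ b

------------------------------------------------------------------------
-- Cayley graphs and cyclotomic classes of a finite field

module _ (F : HeytingField c ℓ₁ ℓ₂) where
  open HeytingField F using (Carrier; _≈_; _#_; 0#; 1#; _-_; setoid; #-irrefl;
    +-cong; -‿cong; +-congˡ; -‿inverseʳ; heytingCommutativeRing)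
    renaming (trans to ≈-trans; sym to ≈-sym; refl to ≈-refl)
  private
    R = record { isCommutativeRing = HeytingField.isCommutativeRing F }
    module R = CommutativeRing R
    module H = HCRProperties heytingCommutativeRing
  open ExpProperties R.semiring using () renaming (_^_ to _^ᶠ_)

  -- A decidable subset of F*.
  record ConnectionSet (ℓ : Level) : Set (c ⊔ ℓ₁ ⊔ ℓ₂ ⊔ lsuc ℓ) where
    field
      Member      : Pred Carrier ℓ
      member?     : Decidable₁ Member
      member-resp : ∀ {x y} → x ≈ y → Member x → Member y
      ⊆units      : ∀ {x} → Member x → x # 0#

  Cay : ∀ {q ℓ} → Enumeration q setoid → ConnectionSet ℓ → Graph c ℓ₁ ℓ
  Cay {q} enum D = record
    { vertices = setoid
    ; order    = q
    ; enum     = enum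
    ; _~_      = λ x y → Member (x - y)
    ; _~?_     = λ x y → member? (x - y)
    ; ~-resp   = (λ eq → member-resp (+-congˡ (-‿cong eq)))
               , (λ eq → member-resp (+-cong eq ≈-refl))
    ; ~-irrefl = λ x≈y x~y → #-irrefl
        (≈-trans (+-cong x≈y ≈-refl) (-‿inverseʳ _)) (⊆units x~y)
    }
    where open ConnectionSet D

  record IsPrimitive (γ : Carrier) : Set (c ⊔ ℓ₁ ⊔ ℓ₂) where
    field
      unit      : γ # 0#
      generates : ∀ x → x # 0# → ∃[ e ] x ≈ γ ^ᶠ e

  cyclotomicClass : Carrier → (q N : ℕ) .{{_ : NonZero N}} → ℕ → Pred Carrier ℓ₁
  cyclotomicClass γ q N i x =
    Σ[ j ∈ Fin ((q ∸ 1) / N) ] x ≈ γ ^ᶠ (i + toℕ j * N)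

  -- The union of the classes C₀, …, Cᵣ₋₁.
  cyclotomicUnion : ∀ {q} → Enumeration q setoid → (γ : Carrier) → IsPrimitive γ →
                    (N : ℕ) .{{_ : NonZero N}} → ℕ → ConnectionSet ℓ₁
  cyclotomicUnion {q} enum γ prim N r = record
    { Member      = λ x → Σ[ i ∈ Fin r ] cyclotomicClass γ q N (toℕ i) x
    ; member?     = λ x → Fin.any? λ i → Fin.any? λ j → ≈-dec enum x _
    ; member-resp = λ eq (i , j , x≈) → i , j , ≈-trans (≈-sym eq) x≈
    ; ⊆units      = λ (i , j , x≈) → H.#-congʳ (≈-sym x≈) (power-unit (toℕ i + toℕ j * N))
    }
    where
    power-unit : ∀ e → γ ^ᶠ e # 0#
    power-unit zero    = H.1#0
    power-unit (suc e) = H.x#0y#0→xy#0 (IsPrimitive.unit prim) (power-unit e)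

{-# OPTIONS --safe #-}

-- Write N = p₁ M and let ψ be a nontrivial additive character of F_q with ψ(xᵖ) = ψ(x). The
-- Fourier transform of D at γᵗ is η(t) + η(t + 1) + … + η(t + M − 1), where η(s) = Σ_{x ∈ C_s} ψ(x)
-- depends only on s mod N and is invariant under s ↦ p s. Since w divides p₁ − 1, the group ⟨p⟩
-- contains every residue that is 1 mod p₁; hence η(t + M) = η(t) whenever M does not divide t, and
-- the transform at γᵗ is κ + η(M b) with b = ⌈t / M⌉ and κ independent of t. The value η(M b) only
-- depends on the orbit of b mod p₁ under multiplication by p: the orbit of 0, or one of at most w
-- others. So λ ranges over at most w + 1 values, and Π (θ − λ) annihilates the Fourier transform of
-- every θ-eigenvector orthogonal to the all-one vector.
--
-- K need not contain p-th roots of unity, and constructively a field K(ζₚ) need not be available.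
-- A nonzero commutative ring over K that contains the values of ψ suffices: there Π (θ − λ) = 0, and
-- a monic polynomial of degree w + 1 has at most w + 1 roots with cancellable differences.
module Submission where

-- The index w is prime to p₁, so ⟨p⟩ contains the Sylow p₁-subgroup of (ℤ/N)*, which is the kernel
-- of reduction mod p₁. The proof replaces subgroups by counts of exponents: lifting congruences
-- from p₁ to N shows that p has order at least (p₁ - 1)/w mod p₁, and this same bound limits the
-- number of orbits.
--
-- The shape of the character ring comes from a conflict. Relations are easy to impose on the group
-- algebra of F_q over K by dividing by the ideal they generate, but then 1 ≠ 0 is hard to see.
-- Dividing instead by the annihilator of explicit elements turns each relation, and also 1 ≠ 0,
-- into a computation. The price is that the ring may have zero divisors: from (θ - λ) v̂(a) = 0 and
-- v̂(a) ≠ 0 nothing follows about θ - λ. The product over all λ does not depend on a, so it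
-- annihilates the whole transform, and Fourier inversion carries this back to the entries of v,
-- which lie in K and can be cancelled.

module Arithmetic where
  open import Defs
  open import Data.Bool.Base using (Bool; true; false; if_then_else_)
  open import Data.Fin.Base as Fin using (Fin; toℕ; fromℕ<; punchOut)
  import Data.Fin.Properties as Fin
  import Data.Integer.Base as ℤ
  import Data.Integer.Properties as ℤ
  open import Data.List.Base as List using (List; _∷_; deduplicate)
  open import Data.List.Membership.Propositional.Properties using (∈-lookup)
  open import Data.List.Relation.Unary.All as All using ()
  open import Data.List.Relation.Unary.AllPairs using (AllPairs; _∷_)
  open import Data.List.Properties using (length-map)
  import Data.List.Relation.Unary.Any.Properties as Any
  import Data.List.Relation.Unary.Unique.DecSetoid.Properties as Unique
  open import Data.List.Relation.Unary.Any using (Any; here; there)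
  open import Data.Nat.Base
  open import Data.Nat.Properties
  open import Data.Nat.DivMod
  open import Data.Nat.Divisibility
  open import Data.Nat.Coprimality as Coprimality using (Coprime)
  open import Data.Nat.GCD using (module Bézout; GCD; module GCD; mkGCD)
  open import Data.Nat.Primality
  open import Data.Nat.Tactic.RingSolver using (solve-∀)
  open import Data.Product.Base using (∃-syntax; _×_; _,_; proj₁; proj₂; map; uncurry)
  open import Data.Sum.Base using (inj₁; inj₂; [_,_]′)
  open import Data.Vec.Base as Vec using (count)
  open import Function.Base using (_∘_; id)
  open import Function.Bundles using (mk⇔)
  open import Function.Definitions using (Injective)
  open import Relation.Binary.Bundles using (Setoid; DecSetoid)
  open import Relation.Binary.PropositionalEquality
  open import Relation.Binary.Core using (Rel)
  open import Relation.Binary.Definitions using (Symmetric)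
  import Relation.Binary.Reasoning.Setoid as SetoidReasoning
  open import Relation.Nullary using (¬_; Dec; yes; no; contradiction; does; ¬?)
  open import Relation.Nullary.Decidable using (map′; does-⇔; does-≡)

  -- Congruence modulo n: unlike a % n ≡ b % n, this form needs no NonZero instance.
  infix 4 _≅_[_]

  record _≅_[_] (a b n : ℕ) : Set where
    constructor mk≅
    field
      {k l} : ℕ
      eq    : a + k * n ≡ b + l * n

  private
    variable
      a b c d m n : ℕ

  ≡⇒≅ : a ≡ b → a ≅ b [ n ]
  ≡⇒≅ refl = mk≅ {k = 0} {0} refl

  ≅-refl : a ≅ a [ n ]
  ≅-refl = ≡⇒≅ refl

  ≅-sym : a ≅ b [ n ] → b ≅ a [ n ]
  ≅-sym (mk≅ {k} {l} eq) = mk≅ {k = l} {k} (sym eq)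

  ≅-trans : a ≅ b [ n ] → b ≅ c [ n ] → a ≅ c [ n ]
  ≅-trans {a} {b} {n} {c} (mk≅ {k} {l} eq) (mk≅ {k′} {l′} eq′) = mk≅ {k = k + k′} {l + l′} (begin
    a + (k + k′) * n     ≡⟨ lemma₁ a k k′ n ⟩
    a + k * n + k′ * n   ≡⟨ cong (_+ k′ * n) eq ⟩
    b + l * n + k′ * n   ≡⟨ lemma₂ b l k′ n ⟩
    b + k′ * n + l * n   ≡⟨ cong (_+ l * n) eq′ ⟩
    c + l′ * n + l * n   ≡⟨ lemma₃ c l l′ n ⟩
    c + (l + l′) * n     ∎)
    where
    open ≡-Reasoning
    lemma₁ : ∀ a k k′ n → a + (k + k′) * n ≡ a + k * n + k′ * n
    lemma₁ = solve-∀
    lemma₂ : ∀ b l k′ n → b + l * n + k′ * n ≡ b + k′ * n + l * n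
    lemma₂ = solve-∀
    lemma₃ : ∀ c l l′ n → c + l′ * n + l * n ≡ c + (l + l′) * n
    lemma₃ = solve-∀

  ≅-setoid : ℕ → Setoid _ _
  ≅-setoid n = record
    { _≈_           = _≅_[ n ]
    ; isEquivalence = record { refl = ≅-refl ; sym = ≅-sym ; trans = ≅-trans }
    }

  module ≅-Reasoning (n : ℕ) = SetoidReasoning (≅-setoid n)

  ≅-+-cong : a ≅ b [ n ] → c ≅ d [ n ] → a + c ≅ b + d [ n ]
  ≅-+-cong {a} {b} {n} {c} {d} (mk≅ {k} {l} eq) (mk≅ {k′} {l′} eq′) = mk≅ {k = k + k′} {l + l′}
    (trans (lemma a c k k′ n) (trans (cong₂ _+_ eq eq′) (sym (lemma b d l l′ n))))
    where
    lemma : ∀ a c k k′ n → a + c + (k + k′) * n ≡ (a + k * n) + (c + k′ * n)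
    lemma = solve-∀

  ≅-*-cong : a ≅ b [ n ] → c ≅ d [ n ] → a * c ≅ b * d [ n ]
  ≅-*-cong {a} {b} {n} {c} {d} (mk≅ {k} {l} eq) (mk≅ {k′} {l′} eq′) =
    mk≅ {k = a * k′ + k * c + k * k′ * n} {b * l′ + l * d + l * l′ * n}
    (trans (lemma a c k k′ n) (trans (cong₂ _*_ eq eq′) (sym (lemma b d l l′ n))))
    where
    lemma : ∀ a c k k′ n → a * c + (a * k′ + k * c + k * k′ * n) * n ≡ (a + k * n) * (c + k′ * n)
    lemma = solve-∀

  ≅-^-cong : ∀ e → a ≅ b [ n ] → a ^ e ≅ b ^ e [ n ]
  ≅-^-cong zero    a≅b = ≅-refl
  ≅-^-cong (suc e) a≅b = ≅-*-cong a≅b (≅-^-cong e a≅b)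

  ≅-*-monoˡ : ∀ c → a ≅ b [ n ] → c * a ≅ c * b [ c * n ]
  ≅-*-monoˡ {a} {b} {n} c (mk≅ {k} {l} eq) = mk≅ {k = k} {l}
    (trans (lemma a c k n) (trans (cong (c *_) eq) (sym (lemma b c l n))))
    where
    lemma : ∀ a c k n → c * a + k * (c * n) ≡ c * (a + k * n)
    lemma = solve-∀

  ≅-∣ : m ∣ n → a ≅ b [ n ] → a ≅ b [ m ]
  ≅-∣ {m} {a = a} {b} (divides-refl r) (mk≅ {k} {l} eq) = mk≅ {k = k * r} {l * r}
    (trans (cong (a +_) (*-assoc k r m)) (trans eq (cong (b +_) (sym (*-assoc l r m)))))

  ∣⇒≅0 : n ∣ a → a ≅ 0 [ n ]
  ∣⇒≅0 {n} (divides q eq) = mk≅ {k = 0} {q} (trans (+-identityʳ _) eq)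

  +k*≅ : ∀ a k n → a + k * n ≅ a [ n ]
  +k*≅ a k n = mk≅ {k = 0} {k} (+-identityʳ _)

  %-≅ : ∀ a n .{{_ : NonZero n}} → a % n ≅ a [ n ]
  %-≅ a n = mk≅ {k = a / n} {0} (trans (sym (m≡m%n+[m/n]*n a n)) (sym (+-identityʳ a)))

  ≅⇒%≡ : .{{_ : NonZero n}} → a ≅ b [ n ] → a % n ≡ b % n
  ≅⇒%≡ {n} {a} {b} (mk≅ {k} {l} eq) = begin
    a % n             ≡⟨ [m+kn]%n≡m%n a k n ⟨
    (a + k * n) % n   ≡⟨ cong (_% n) eq ⟩
    (b + l * n) % n   ≡⟨ [m+kn]%n≡m%n b l n ⟩
    b % n             ∎
    where open ≡-Reasoning

  %≡⇒≅ : .{{_ : NonZero n}} → a % n ≡ b % n → a ≅ b [ n ]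
  %≡⇒≅ {n} {a} {b} eq = ≅-trans (≅-sym (%-≅ a n)) (≅-trans (≡⇒≅ eq) (%-≅ b n))

  ≅⇒≡ : .{{_ : NonZero n}} → a < n → b < n → a ≅ b [ n ] → a ≡ b
  ≅⇒≡ a<n b<n a≅b = trans (sym (m<n⇒m%n≡m a<n)) (trans (≅⇒%≡ a≅b) (m<n⇒m%n≡m b<n))

  ≅-+⇒∣ : ∀ b → b + d ≅ b [ n ] → n ∣ d
  ≅-+⇒∣ {d} {n} b (mk≅ {k} {l} eq) = ∣m+n∣m⇒∣n (divides l
    (+-cancelˡ-≡ b (k * n + d) (l * n) (trans (lemma b d (k * n)) eq))) (divides k refl)
    where
    lemma : ∀ b d k → b + (k + d) ≡ b + d + k
    lemma = solve-∀

  ≅0⇒∣ : a ≅ 0 [ n ] → n ∣ a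
  ≅0⇒∣ = ≅-+⇒∣ 0

  ≅-+-cancelˡ : ∀ c → c + a ≅ c + b [ n ] → a ≅ b [ n ]
  ≅-+-cancelˡ {a} {b} {n} c (mk≅ {k} {l} eq) = mk≅ {k = k} {l} (+-cancelˡ-≡ c _ _
    (trans (sym (+-assoc c a (k * n))) (trans eq (+-assoc c b (l * n)))))

  ≅-*-cancelˡ : ∀ c → Coprime n c → c * a ≅ c * b [ n ] → a ≅ b [ n ]
  ≅-*-cancelˡ {n} {a} {b} c cop ca≅cb = [ wlog ca≅cb , ≅-sym ∘ wlog (≅-sym ca≅cb) ]′ (≤-total b a)
    where
    wlog : ∀ {a b} → c * a ≅ c * b [ n ] → b ≤ a → a ≅ b [ n ]
    wlog {a} {b} ca≅cb b≤a with d , refl ← m≤n⇒∃[o]m+o≡n b≤a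
      with divides q refl ← Coprimality.coprime-divisor cop
        (≅-+⇒∣ (c * b) (≅-trans (≡⇒≅ (sym (*-distribˡ-+ c b d))) ca≅cb)) = +k*≅ b q n

  -- Multiplicative orders

  ≡[mod]⇒≅ : (ℤ.+ a) ≡ (ℤ.+ b) [mod n ] → a ≅ b [ n ]
  ≡[mod]⇒≅ {a} {b} {n} n∣a-b = [ wlog n∣a-b , ≅-sym ∘ wlog n∣b-a ]′ (≤-total b a)
    where
    n∣b-a : (ℤ.+ b) ≡ (ℤ.+ a) [mod n ]
    n∣b-a = subst (n ∣_) (trans (cong ℤ.∣_∣ (ℤ.[+m]-[+n]≡m⊖n a b)) (trans (ℤ.∣m⊖n∣≡∣n⊖m∣ a b)
      (sym (cong ℤ.∣_∣ (ℤ.[+m]-[+n]≡m⊖n b a))))) n∣a-b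
    wlog : ∀ {a b} → (ℤ.+ a) ≡ (ℤ.+ b) [mod n ] → b ≤ a → a ≅ b [ n ]
    wlog {a} {b} n∣a-b b≤a with d , refl ← m≤n⇒∃[o]m+o≡n b≤a
      with divides q d≡q*n ← subst (n ∣_) (trans (cong ℤ.∣_∣ (trans (ℤ.[+m]-[+n]≡m⊖n (b + d) b) (ℤ.⊖-≥ b≤a))) (m+n∸m≡n b d)) n∣a-b
      rewrite d≡q*n = +k*≅ b q n

  ≅⇒≡[mod] : a ≅ b [ n ] → (ℤ.+ a) ≡ (ℤ.+ b) [mod n ]
  ≅⇒≡[mod] {a} {b} {n} a≅b = [ wlog a≅b , flip ∘ wlog (≅-sym a≅b) ]′ (≤-total b a)
    where
    flip : (ℤ.+ b) ≡ (ℤ.+ a) [mod n ] → (ℤ.+ a) ≡ (ℤ.+ b) [mod n ]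
    flip = subst (n ∣_) (trans (cong ℤ.∣_∣ (ℤ.[+m]-[+n]≡m⊖n b a)) (trans (ℤ.∣m⊖n∣≡∣n⊖m∣ b a)
      (sym (cong ℤ.∣_∣ (ℤ.[+m]-[+n]≡m⊖n a b)))))
    wlog : ∀ {a b} → a ≅ b [ n ] → b ≤ a → (ℤ.+ a) ≡ (ℤ.+ b) [mod n ]
    wlog {a} {b} a≅b b≤a with d , refl ← m≤n⇒∃[o]m+o≡n b≤a =
      subst (n ∣_) (sym (trans (cong ℤ.∣_∣ (trans (ℤ.[+m]-[+n]≡m⊖n (b + d) b) (ℤ.⊖-≥ b≤a))) (m+n∸m≡n b d)))
        (≅-+⇒∣ b a≅b)

  pos-^ : ∀ a e → (ℤ.+ a) ℤ.^ e ≡ ℤ.+ (a ^ e)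
  pos-^ a zero    = refl
  pos-^ a (suc e) = trans (cong (ℤ.+ a ℤ.*_) (pos-^ a e)) (sym (ℤ.pos-* a (a ^ e)))

  module _ {p N f} (ord : IsOrder p N f) where
    open IsOrder ord

    order-power : p ^ f ≅ 1 [ N ]
    order-power = ≡[mod]⇒≅ (subst (_≡ ℤ.+ 1 [mod N ]) (pos-^ p f) power≡1)

    order-≤ : ∀ g → 1 ≤ g → p ^ g ≅ 1 [ N ] → f ≤ g
    order-≤ g 1≤g eq = minimal g 1≤g (subst (_≡ ℤ.+ 1 [mod N ]) (sym (pos-^ p g)) (≅⇒≡[mod] eq))

    order-coprime : Coprime p N
    order-coprime = λ (d∣p , d∣N) → ∣1⇒≡1 (≅0⇒∣ (≅-trans (≅-sym (≅-∣ d∣N order-power))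
      (∣⇒≅0 (∣-trans d∣p (p∣p^ positive)))))
      where
      p∣p^ : ∀ {e} → 1 ≤ e → p ∣ p ^ e
      p∣p^ (s≤s _) = m∣m*n _

    order-^* : ∀ k → p ^ (k * f) ≅ 1 [ N ]
    order-^* zero    = ≅-refl
    order-^* (suc k) = ≅-trans (≡⇒≅ (^-distribˡ-+-* p f (k * f))) (≅-*-cong order-power (order-^* k))

    order-^% : .{{_ : NonZero f}} → ∀ e → p ^ (e % f) ≅ p ^ e [ N ]
    order-^% e = begin
      p ^ (e % f)                       ≡⟨ *-identityʳ _ ⟨
      p ^ (e % f) * 1                   ≈⟨ ≅-*-cong (≅-refl {p ^ (e % f)}) (order-^* (e / f)) ⟨
      p ^ (e % f) * p ^ (e / f * f)     ≡⟨ ^-distribˡ-+-* p (e % f) (e / f * f) ⟨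
      p ^ (e % f + e / f * f)           ≡⟨ cong (p ^_) (m≡m%n+[m/n]*n e f) ⟨
      p ^ e                             ∎
      where open ≅-Reasoning N

    order-∣ : ∀ e → p ^ e ≅ 1 [ N ] → f ∣ e
    order-∣ e eq = helper (e % f) refl
      where
      instance _ = >-nonZero positive
      helper : ∀ r → e % f ≡ r → f ∣ e
      helper zero    e%f≡0 = m%n≡0⇒n∣m e f e%f≡0
      helper (suc r) e%f≡r = contradiction (order-≤ (e % f) (subst (1 ≤_) (sym e%f≡r) (s≤s z≤n)) (≅-trans (order-^% e) eq)) (<⇒≱ (m%n<n e f))

  -- Lifting congruences to higher prime powers

  -- The binomial theorem cut off after the linear term; of the remainder only the factor a² matters
  -- later.
  [1+a]^n-expansion : ∀ a n → ∃[ c ] (1 + a) ^ n ≡ 1 + n * a + a * a * c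
  [1+a]^n-expansion a zero  = 0 , cong suc (sym (*-zeroʳ (a * a)))
  [1+a]^n-expansion a (suc n) with c , eq ← [1+a]^n-expansion a n = n + c + a * c , trans (cong ((1 + a) *_) eq) (lemma a n c)
    where
    lemma : ∀ a n c → (1 + a) * (1 + n * a + a * a * c) ≡ 1 + (1 + n) * a + a * a * (n + c + a * c)
    lemma = solve-∀

  -- For a = 1 + y n the expansion is 1 + r y n + y² n² z, and r ∣ n makes the quadratic term a
  -- multiple of r n too.
  ≅1-lift : ∀ r .{{_ : NonZero r}} → r ∣ n → a ≅ 1 [ n ] → a ^ r ≅ 1 [ r * n ]
  ≅1-lift {n} {a} r@(suc r′) (divides q n≡q*r) (mk≅ {k} {l} eq) = begin
    -- Adding a multiple of `r * n` to `a` first brings it to the form `1 + y * n` without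
    -- subtraction.
    a ^ r                                          ≈⟨ ≅-^-cong r (+k*≅ a k (r * n)) ⟨
    (a + k * (r * n)) ^ r                          ≡⟨ cong (_^ r) (trans (lemma₁ a k r′ n) (cong (_+ k * r′ * n) eq)) ⟩
    (1 + l * n + k * r′ * n) ^ r                   ≡⟨ cong (_^ r) (lemma₂ k l r′ n) ⟩
    (1 + y * n) ^ r                                ≡⟨ proj₂ ([1+a]^n-expansion (y * n) r) ⟩
    1 + r * (y * n) + y * n * (y * n) * z          ≡⟨ cong (λ m → 1 + r * (y * n) + y * m * (y * n) * z) n≡q*r ⟩
    1 + r * (y * n) + y * (q * r) * (y * n) * z    ≡⟨ lemma₃ r y n q z ⟩
    1 + (y + y * q * y * z) * (r * n)              ≈⟨ +k*≅ 1 (y + y * q * y * z) (r * n) ⟩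
    1                                              ∎
    where
    open ≅-Reasoning (r * n)
    y = l + k * r′
    z = proj₁ ([1+a]^n-expansion (y * n) r)
    lemma₁ : ∀ a k r′ n → a + k * (suc r′ * n) ≡ a + k * n + k * r′ * n
    lemma₁ = solve-∀
    lemma₂ : ∀ k l r′ n → 1 + l * n + k * r′ * n ≡ 1 + (l + k * r′) * n
    lemma₂ = solve-∀
    lemma₃ : ∀ r y n q c → 1 + r * (y * n) + y * (q * r) * (y * n) * c ≡ 1 + (y + y * q * y * c) * (r * n)
    lemma₃ = solve-∀

  ≅1-lift-^ : ∀ r .{{_ : NonZero r}} j → a ≅ 1 [ r ] → a ^ (r ^ j) ≅ 1 [ r ^ suc j ]
  ≅1-lift-^ {a} r zero    a≅1 = subst₂ (_≅ 1 [_]) (sym (*-identityʳ a)) (sym (*-identityʳ r)) a≅1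
  ≅1-lift-^ {a} r (suc j) a≅1 = subst (_≅ 1 [ r ^ suc (suc j) ]) (trans (^-*-assoc a (r ^ j) r) (cong (a ^_) (*-comm (r ^ j) r)))
    (≅1-lift r (m∣m*n (r ^ j)) (≅1-lift-^ r j a≅1))

  -- If y were missed, punching it out of the codomain would inject a set of n + 1 elements into one
  -- of n.
  injective⇒surjective : (f : Fin n → Fin n) → Injective _≡_ _≡_ f → ∀ y → ∃[ x ] f x ≡ y
  injective⇒surjective {suc n} f f-inj y with Fin.any? (λ x → f x Fin.≟ y)
  ... | yes hit = hit
  ... | no miss = contradiction (Fin.injective⇒≤ {f = λ x → punchOut (y≢f x)}
    λ eq → f-inj (Fin.punchOut-injective (y≢f _) (y≢f _) eq)) 1+n≰n
    where
    y≢f : ∀ x → y ≢ f x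
    y≢f x y≡fx = miss (x , sym y≡fx)

  prime∤⇒coprime : Prime m → m ∤ n → Coprime n m
  prime∤⇒coprime pm m∤n (d∣n , d∣m) with prime⇒irreducible pm d∣m
  ... | inj₁ d≡1  = d≡1
  ... | inj₂ refl = contradiction d∣n m∤n

  ∤∧∣^⇒≡1 : Prime m → ∀ e → m ∤ d → d ∣ m ^ e → d ≡ 1
  ∤∧∣^⇒≡1 pm zero    m∤d d∣1   = ∣1⇒≡1 d∣1
  ∤∧∣^⇒≡1 pm (suc e) m∤d d∣m^e =
    ∤∧∣^⇒≡1 pm e m∤d (Coprimality.coprime-divisor (prime∤⇒coprime pm m∤d) d∣m^e)

  ∤⇒coprime-^ : Prime m → ∀ e → m ∤ n → Coprime n (m ^ e)
  ∤⇒coprime-^ pm e m∤n (d∣n , d∣m^e) = ∤∧∣^⇒≡1 pm e (λ m∣d → m∤n (∣-trans m∣d d∣n)) d∣m^e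

  -- The totient of a prime power

  -- Counting along ℕ instead of `Fin` lets periodicity be stated as a plain shift of the predicate.
  cnt : (ℕ → Bool) → ℕ → ℕ
  cnt Q zero    = 0
  cnt Q (suc n) = (if Q 0 then 1 else 0) + cnt (Q ∘ suc) n

  cnt-cong : ∀ {Q Q′} n → (∀ i → Q i ≡ Q′ i) → cnt Q n ≡ cnt Q′ n
  cnt-cong zero    eq = refl
  cnt-cong (suc n) eq = cong₂ (λ b k → (if b then 1 else 0) + k) (eq 0) (cnt-cong n (eq ∘ suc))

  cnt-+ : ∀ Q m n → cnt Q (m + n) ≡ cnt Q m + cnt (Q ∘ (m +_)) n
  cnt-+ Q zero    n = refl
  cnt-+ Q (suc m) n = trans (cong (_ +_) (cnt-+ (Q ∘ suc) m n)) (sym (+-assoc (if Q 0 then 1 else 0) _ _))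

  cnt-periodic : ∀ Q m k → (∀ i → Q (m + i) ≡ Q i) → cnt Q (k * m) ≡ k * cnt Q m
  cnt-periodic Q m zero    eq = refl
  cnt-periodic Q m (suc k) eq = trans (cnt-+ Q m (k * m))
    (cong (cnt Q m +_) (trans (cnt-cong (k * m) eq) (cnt-periodic Q m k eq)))

  cnt-true : ∀ Q n → (∀ i → i < n → Q i ≡ true) → cnt Q n ≡ n
  cnt-true Q zero    all = refl
  cnt-true Q (suc n) all rewrite all 0 z<s = cong suc (cnt-true (Q ∘ suc) n (λ i i<n → all (suc i) (s<s i<n)))

  count-cnt : ∀ {A : Set} {P : A → Set} (P? : ∀ x → Dec (P x)) (f : Fin n → A) Q →
              (∀ i → does (P? (f i)) ≡ Q (toℕ i)) → count P? (Vec.tabulate f) ≡ cnt Q n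
  count-cnt {zero}  P? f Q eq = refl
  count-cnt {suc n} P? f Q eq with count-cnt P? (f ∘ Fin.suc) (Q ∘ suc) (eq ∘ Fin.suc) | does (P? (f Fin.zero)) | Q 0 | eq Fin.zero
  ... | rec | true  | true  | refl = cong suc rec
  ... | rec | false | false | refl = rec

  -- Coprimality to a power of m is non-divisibility by m, which has period m and fails only at 0
  -- within one period.
  φ-prime-power : Prime m → ∀ j → φ (m ^ suc j) ≡ m ^ j * (m ∸ 1)
  φ-prime-power {m@(suc m′)} m-prime j = begin
    count coprime-mʲ (Vec.allFin (m ^ suc j))
      ≡⟨ count-cnt {m ^ suc j} coprime-mʲ id ∤m (λ i → does-⇔ (mk⇔ coprime⇒∤ (∤⇒coprime-^ m-prime (suc j))) (coprime-mʲ i) (¬? (m ∣? toℕ i))) ⟩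
    cnt ∤m (m * m ^ j)              ≡⟨ cong (cnt ∤m) (*-comm m (m ^ j)) ⟩
    cnt ∤m (m ^ j * m)              ≡⟨ cnt-periodic ∤m m (m ^ j) (λ i → does-⇔ (mk⇔
            (λ m∤m+i m∣i → m∤m+i (∣m∣n⇒∣m+n ∣-refl m∣i)) (λ m∤i m∣m+i → m∤i (∣m+n∣m⇒∣n m∣m+i ∣-refl))) (¬? (m ∣? (m + i))) (¬? (m ∣? i))) ⟩
    m ^ j * cnt ∤m m                ≡⟨ cong (m ^ j *_) cnt-1 ⟩
    m ^ j * m′                      ∎
    where
    open ≡-Reasoning
    coprime-mʲ : (i : Fin (m ^ suc j)) → Dec (Coprime (toℕ i) (m ^ suc j))
    coprime-mʲ i = Coprimality.coprime? (toℕ i) (m ^ suc j)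
    ∤m : ℕ → Bool
    ∤m i = does (¬? (m ∣? i))
    coprime⇒∤ : ∀ {i} → Coprime i (m ^ suc j) → m ∤ i
    coprime⇒∤ cop m∣i = contradiction (subst Prime (cop (m∣i , m∣m*n (m ^ j))) m-prime) ¬prime[1]
    cnt-1 : cnt ∤m m ≡ m′
    cnt-1 rewrite does-≡ (m ∣? 0) (yes (m ∣0)) = cnt-true (∤m ∘ suc) m′
      (λ i i<m′ → does-≡ (¬? (m ∣? suc i)) (yes (>⇒∤ (s<s i<m′))))

  injective₂⇒*≤ : ∀ {k l} (h : Fin k → Fin l → Fin n) →
                  (∀ i i′ e e′ → h i e ≡ h i′ e′ → i ≡ i′ × e ≡ e′) → k * l ≤ n
  injective₂⇒*≤ {n} {k} {l} h h-inj = Fin.injective⇒≤ {f = h′} h′-inj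
    where
    h′ : Fin (k * l) → Fin n
    h′ x = uncurry h (Fin.remQuot l x)
    h′-inj : Injective _≡_ _≡_ h′
    h′-inj {x} {y} eq with i≡ , e≡ ← h-inj _ _ _ _ eq = begin
      x                                        ≡⟨ Fin.combine-remQuot {k} l x ⟨
      uncurry Fin.combine (Fin.remQuot {k} l x)    ≡⟨ cong₂ Fin.combine i≡ e≡ ⟩
      uncurry Fin.combine (Fin.remQuot {k} l y)    ≡⟨ Fin.combine-remQuot {k} l y ⟩
      y                                        ∎
      where open ≡-Reasoning

  injective⇒surjective-< : (h : ℕ → ℕ) → (∀ a → h a < n) → (∀ {a b} → a < n → b < n → h a ≡ h b → a ≡ b) →
                           ∀ {y} → y < n → ∃[ x ] h x ≡ y
  injective⇒surjective-< {n} h h< h-inj {y} y<n =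
    let k , eq = injective⇒surjective h′ h′-inj (fromℕ< y<n)
    in toℕ k , Fin.fromℕ<-injective _ _ (h< (toℕ k)) y<n eq
    where
    h′ : Fin n → Fin n
    h′ k = fromℕ< (h< (toℕ k))
    h′-inj : Injective _≡_ _≡_ h′
    h′-inj {k} {l} eq = Fin.toℕ-injective
      (h-inj (Fin.toℕ<n k) (Fin.toℕ<n l) (Fin.fromℕ<-injective _ _ (h< (toℕ k)) (h< (toℕ l)) eq))

  ∣∧<⇒≡0 : m ∣ d → d < m → d ≡ 0
  ∣∧<⇒≡0 {d = zero}  m∣d d<m = refl
  ∣∧<⇒≡0 {d = suc _} m∣d d<m = contradiction (∣⇒≤ m∣d) (<⇒≱ d<m)

  allPairs⇒lookup-injective : ∀ {a ℓ} {A : Set a} (R : Rel A ℓ) → Symmetric R →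
    ∀ {xs} → AllPairs (λ x y → ¬ R x y) xs → ∀ i j → R (List.lookup xs i) (List.lookup xs j) → i ≡ j
  allPairs⇒lookup-injective R R-sym (x∉ ∷ u) Fin.zero    Fin.zero    Rij = refl
  allPairs⇒lookup-injective R R-sym (x∉ ∷ u) Fin.zero    (Fin.suc j) Rij =
    contradiction Rij (All.lookup x∉ (∈-lookup j))
  allPairs⇒lookup-injective R R-sym (x∉ ∷ u) (Fin.suc i) Fin.zero    Rij =
    contradiction (R-sym Rij) (All.lookup x∉ (∈-lookup i))
  allPairs⇒lookup-injective R R-sym (x∉ ∷ u) (Fin.suc i) (Fin.suc j) Rij =
    cong Fin.suc (allPairs⇒lookup-injective R R-sym u i j Rij)

  -- Powers of `p` modulo `N` and modulo the prime `r`, which is p₁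

  module CosetArithmetic
    (r : ℕ) .{{_ : NonZero r}} (r-prime : Prime r) (j p f w : ℕ)
    (ord : IsOrder p (r ^ suc j) f) (w*f≡φ : w * f ≡ φ (r ^ suc j)) (w∣r-1 : w ∣ r ∸ 1)
    where

    M N : ℕ
    M = r ^ j
    N = r ^ suc j

    instance
      M≢0 : NonZero M
      M≢0 = m^n≢0 r j
      N≢0 : NonZero N
      N≢0 = m^n≢0 r (suc j)
      f≢0 : NonZero f
      f≢0 = >-nonZero (IsOrder.positive ord)

    r∣N : r ∣ N
    r∣N = m∣m*n M

    1<r : 1 < r
    1<r = nonTrivial⇒n>1 r {{prime⇒nonTrivial r-prime}}

    1≤r-1 : 1 ≤ r ∸ 1
    1≤r-1 = m<n⇒0<n∸m 1<r

    w′ : ℕ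
    w′ = quotient w∣r-1

    r-1≡w*w′ : r ∸ 1 ≡ w * w′
    r-1≡w*w′ = m∣n⇒n≡m*quotient w∣r-1

    instance
      w≢0 : NonZero w
      w≢0 = ≢-nonZero λ { refl → 1+n≰n (subst (1 ≤_) r-1≡w*w′ 1≤r-1) }

    f≡w′*M : f ≡ w′ * M
    f≡w′*M = *-cancelˡ-≡ f (w′ * M) w (begin
      w * f           ≡⟨ trans w*f≡φ (φ-prime-power r-prime j) ⟩
      M * (r ∸ 1)     ≡⟨ cong (M *_) r-1≡w*w′ ⟩
      M * (w * w′)    ≡⟨ lemma M w w′ ⟩
      w * (w′ * M)    ∎)
      where
      open ≡-Reasoning
      lemma : ∀ M w w′ → M * (w * w′) ≡ w * (w′ * M)
      lemma = solve-∀

    p-coprime-N : Coprime p N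
    p-coprime-N = order-coprime ord

    p-coprime-r : Coprime p r
    p-coprime-r (d∣p , d∣r) = p-coprime-N (d∣p , ∣-trans d∣r r∣N)

    p^-coprime : ∀ {n} e → Coprime p n → Coprime n (p ^ e)
    p^-coprime zero    _   (_ , d∣1)     = ∣1⇒≡1 d∣1
    p^-coprime (suc e) cop (d∣n , d∣p^e) = p^-coprime e cop
      (d∣n , Coprimality.coprime-divisor (λ (c∣d , c∣p) → cop (c∣p , ∣-trans c∣d d∣n)) d∣p^e)

    p^-cancel : ∀ {n d} a b → Coprime p n → b * p ^ a ≅ b * p ^ (a + d) [ n ] → Coprime n b → p ^ d ≅ 1 [ n ]
    p^-cancel {n} {d} a b cop eq cop′ = ≅-sym (≅-*-cancelˡ (p ^ a) (p^-coprime a cop)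
      (≅-trans (≡⇒≅ (*-identityʳ (p ^ a))) (≅-trans (≅-*-cancelˡ b cop′ eq) (≡⇒≅ (^-distribˡ-+-* p a d)))))

    -- Raising to the power M lifts p^d ≡ 1 from r to N, so the order f = w′ M is at most d M.
    w′-minimal : ∀ d → 1 ≤ d → p ^ d ≅ 1 [ r ] → w′ ≤ d
    w′-minimal d 1≤d p^d≅1 = *-cancelʳ-≤ w′ d M (subst (_≤ d * M) f≡w′*M
      (order-≤ ord (d * M) (*-mono-≤ 1≤d (>-nonZero⁻¹ M))
        (subst (_≅ 1 [ N ]) (^-*-assoc p d M) (≅1-lift-^ r j p^d≅1))))

    -- Nonzero residues mod r, shifted down by one to lie in Fin (r ∸ 1); multiples of r get the junk value 0.

    residue : ℕ → ℕ
    residue a = pred (a % r)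

    residue< : ∀ a → residue a < r ∸ 1
    residue< a = pred< (a % r) r (m%n<n a r) 1≤r-1
      where
      pred< : ∀ k n → k < n → 1 ≤ n ∸ 1 → pred k < n ∸ 1
      pred< zero    _       _         1≤n-1 = 1≤n-1
      pred< (suc k) (suc n) (s≤s k<n) _     = k<n

    toRes : ℕ → Fin (r ∸ 1)
    toRes a = fromℕ< (residue< a)

    suc-residue : ∀ {a} → r ∤ a → suc (residue a) ≡ a % r
    suc-residue {a} r∤a = suc-pred (a % r) {{≢-nonZero λ eq → r∤a (m%n≡0⇒n∣m a r eq)}}

    toRes-≅ : ∀ {a b} → r ∤ a → r ∤ b → toRes a ≡ toRes b → a ≅ b [ r ]
    toRes-≅ {a} {b} r∤a r∤b eq = %≡⇒≅ (begin
      a % r             ≡⟨ suc-residue r∤a ⟨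
      suc (residue a)   ≡⟨ cong suc (Fin.fromℕ<-injective _ _ _ _ eq) ⟩
      suc (residue b)   ≡⟨ suc-residue r∤b ⟩
      b % r             ∎)
      where open ≡-Reasoning

    r∤p^ : ∀ e → r ∤ p ^ e
    r∤p^ e r∣p^e = contradiction (subst Prime (p^-coprime e p-coprime-r (∣-refl , r∣p^e)) r-prime) ¬prime[1]

    ∤-* : ∀ {a b} → r ∤ a → r ∤ b → r ∤ a * b
    ∤-* {a} {b} r∤a r∤b r∣ab = [ r∤a , r∤b ]′ (euclidsLemma a b r-prime r∣ab)

    abstract
      -- The r powers p⁰, ..., p^(r - 1) fall into r - 1 nonzero residues. The bound `g < r` is what
      -- makes g prime to M.
      small-order : ∃[ g ] 1 ≤ g × g < r × p ^ g ≅ 1 [ r ]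
      small-order
        with a , b , a<b , eq ← Fin.pigeonhole {m = r ∸ 1} {r} (∸-monoʳ-< z<s (<⇒≤ 1<r)) (λ i → toRes (p ^ toℕ i))
        with d , a+d≡b ← m≤n⇒∃[o]m+o≡n (<⇒≤ a<b) = d , 1≤d , ≤-<-trans d≤b (Fin.toℕ<n b) , p^d≅1
        where
        d≤b : d ≤ toℕ b
        d≤b = subst (d ≤_) a+d≡b (m≤n+m d (toℕ a))
        1≤d : 1 ≤ d
        1≤d = +-cancelˡ-< (toℕ a) 0 d (subst₂ _<_ (sym (+-identityʳ (toℕ a))) (sym a+d≡b) a<b)
        p^d≅1 : p ^ d ≅ 1 [ r ]
        p^d≅1 = p^-cancel (toℕ a) 1 p-coprime-r (≅-*-cong (≅-refl {1}) (subst (λ b → p ^ toℕ a ≅ p ^ b [ r ]) (sym a+d≡b)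
          (toRes-≅ (r∤p^ (toℕ a)) (r∤p^ (toℕ b)) eq))) (λ (_ , d∣1) → ∣1⇒≡1 d∣1)

    g : ℕ
    g = proj₁ small-order

    p^g : ℕ → ℕ
    p^g k = p ^ (g * k)

    p^g≅1 : ∀ k → p^g k ≅ 1 [ r ]
    p^g≅1 k = subst₂ (_≅_[ r ]) (^-*-assoc p g k) (^-zeroˡ k)
      (≅-^-cong k (proj₂ (proj₂ (proj₂ small-order))))

    -- For d = b - a the order f, hence its divisor M, divides g d. Since 0 < g < r, M is prime to
    -- g, so M divides d < M.
    p^g-injective : ∀ {a b} → a ≤ b → b < M → p^g a ≅ p^g b [ N ] → a ≡ b
    p^g-injective {a} {b} a≤b b<M eq
      with d , refl ← m≤n⇒∃[o]m+o≡n a≤b = sym (trans (cong (a +_) d≡0) (+-identityʳ a))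
      where
      p^gd≅1 : p ^ (g * d) ≅ 1 [ N ]
      p^gd≅1 = p^-cancel (g * a) 1 p-coprime-N (≅-*-cong (≅-refl {1})
        (≅-trans eq (≡⇒≅ (cong (p ^_) (*-distribˡ-+ g a d))))) (λ (_ , d∣1) → ∣1⇒≡1 d∣1)
      1≤g : 1 ≤ g
      1≤g = proj₁ (proj₂ small-order)
      g<r : g < r
      g<r = proj₁ (proj₂ (proj₂ small-order))
      M∣gd : M ∣ g * d
      M∣gd = ∣-trans (divides w′ f≡w′*M) (order-∣ ord (g * d) p^gd≅1)
      M∣d : M ∣ d
      M∣d = Coprimality.coprime-divisor (Coprimality.sym
        (∤⇒coprime-^ r-prime j (>⇒∤ {{>-nonZero 1≤g}} g<r))) M∣gd
      d≡0 : d ≡ 0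
      d≡0 = ∣∧<⇒≡0 M∣d (≤-<-trans (m≤n+m d a) b<M)

    -- A residue mod N that is 1 mod r has the form 1 + h r with h < M; this reads off h and so
    -- numbers these residues.
    height : ℕ → ℕ
    height a = a % N / r

    height< : ∀ a → height a < M
    height< a = m<n*o⇒m/o<n (subst (a % N <_) (*-comm r M) (m%n<n a N))

    height-determines : ∀ {a b} → a ≅ 1 [ r ] → b ≅ 1 [ r ] → height a ≡ height b → a ≅ b [ N ]
    height-determines {a} {b} a≅1 b≅1 eq = %≡⇒≅ (begin
      a % N                               ≡⟨ m≡m%n+[m/n]*n (a % N) r ⟩
      a % N % r + height a * r            ≡⟨ cong₂ (λ x h → x + h * r) %r≡ eq ⟩
      b % N % r + height b * r            ≡⟨ m≡m%n+[m/n]*n (b % N) r ⟨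
      b % N                               ∎)
      where
      open ≡-Reasoning
      %r≡ : a % N % r ≡ b % N % r
      %r≡ = ≅⇒%≡ (≅-trans (≅-∣ r∣N (%-≅ a N)) (≅-trans (≅-trans a≅1 (≅-sym b≅1)) (≅-sym (≅-∣ r∣N (%-≅ b N)))))

    p^g-height-injective : ∀ {a b} → a < M → b < M → height (p^g a) ≡ height (p^g b) → a ≡ b
    p^g-height-injective {a} {b} a<M b<M eq =
      [ (λ a≤b → p^g-injective a≤b b<M same) , (λ b≤a → sym (p^g-injective b≤a a<M (≅-sym same))) ]′ (≤-total a b)
      where
      same : p^g a ≅ p^g b [ N ]
      same = height-determines (p^g≅1 a) (p^g≅1 b) eq

    p^g-height-surjective : ∀ {s} → s ≅ 1 [ r ] → ∃[ k ] height (p^g k) ≡ height s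
    p^g-height-surjective {s} _ =
      injective⇒surjective-< (λ a → height (p^g a)) (λ a → height< (p^g a)) p^g-height-injective (height< s)

    p^g-surjective : ∀ {s} → s ≅ 1 [ r ] → ∃[ k ] p^g k ≅ s [ N ]
    p^g-surjective {s} s≅1 = k , height-determines {p^g k} {s} (p^g≅1 k) s≅1 (proj₂ (p^g-height-surjective s≅1))
      where
      k = proj₁ (p^g-height-surjective s≅1)

    -- The M distinct powers p^g k exhaust the M residue classes mod N that are 1 mod r.
    abstract
      unit-power : ∀ {s} → s ≅ 1 [ r ] → ∃[ e ] p ^ e ≅ s [ N ]
      unit-power s≅1 = g * proj₁ (p^g-surjective s≅1) , proj₂ (p^g-surjective s≅1)

    bézout-≅ : ∀ {a c} → GCD a N c → ∃[ u ] u * a ≅ c [ N ]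
    bézout-≅ {a} {c} gcd with Bézout.identity gcd
    ... | Bézout.+- x y c+yN≡xa = x , ≅-trans (≡⇒≅ (sym c+yN≡xa)) (+k*≅ c y N)
    -- The coefficient wanted here is -x; mod N it is represented by (N - 1) x.
    ... | Bézout.-+ x y c+xa≡yN = pred N * x , (begin
      pred N * x * a                  ≈⟨ ≅-+-cong (∣⇒≅0 (divides y c+xa≡yN)) (≅-refl {pred N * x * a}) ⟨
      c + x * a + pred N * x * a      ≡⟨ lemma c x a (pred N) ⟩
      c + x * a * suc (pred N)        ≡⟨ cong (λ n → c + x * a * n) (suc-pred N) ⟩
      c + x * a * N                   ≈⟨ +k*≅ c (x * a) N ⟩
      c                               ∎)
      where
      open ≅-Reasoning N
      lemma : ∀ c x a n → c + x * a + n * x * a ≡ c + x * a * suc n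
      lemma = solve-∀

    -- Write N = c′ c. If r divides c′, then c divides N / r = M. Otherwise c′ = 1, so N = c divides
    -- r t and M divides t.
    gcd∣M : ∀ {t c} → M ∤ t → GCD (r * t) N c → c ∣ M
    gcd∣M {t} {c} M∤t gcd with divides c′ N≡c′*c ← GCD.gcd∣n gcd with r ∣? c′
    ... | yes (divides-refl k) = divides k (*-cancelˡ-≡ M (k * c) r (trans N≡c′*c (lemma k r c)))
      where
      lemma : ∀ k r c → k * r * c ≡ r * (k * c)
      lemma = solve-∀
    ... | no r∤c′ = contradiction (*-cancelˡ-∣ r (subst (_∣ r * t) (sym N≡c) (GCD.gcd∣m gcd))) M∤t
      where
      N≡c : N ≡ c
      N≡c = trans N≡c′*c (trans (cong (_* c) (∤∧∣^⇒≡1 r-prime (suc j) r∤c′ (divides c (trans N≡c′*c (*-comm c′ c))))) (*-identityˡ c))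

    -- A multiplier 1 + y r sends t to t + M exactly when y r t ≡ M mod N. This is solvable because
    -- gcd(r t, N) divides M, and every such multiplier is a power of p.
    shift-power : ∀ t → M ∤ t → ∃[ e ] p ^ e * t ≅ t + M [ N ]
    shift-power t M∤t
      with c , gcd ← mkGCD (r * t) N
      with divides q M≡q*c ← gcd∣M M∤t gcd
      with u , u*rt≅c ← bézout-≅ gcd
      with e , p^e≅ ← unit-power {1 + q * u * r} (+k*≅ 1 (q * u) r) = e , (begin
        p ^ e * t                 ≈⟨ ≅-*-cong p^e≅ (≅-refl {t}) ⟩
        (1 + q * u * r) * t       ≡⟨ lemma q u r t ⟩
        t + q * (u * (r * t))     ≈⟨ ≅-+-cong (≅-refl {t}) (≅-*-cong (≅-refl {q}) u*rt≅c) ⟩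
        t + q * c                 ≡⟨ cong (t +_) M≡q*c ⟨
        t + M                     ∎)
      where
      open ≅-Reasoning N
      lemma : ∀ q u r t → (1 + q * u * r) * t ≡ t + q * (u * (r * t))
      lemma = solve-∀

    -- Orbits of multiplication by p on the residues mod r

    record _~_ (a b : ℕ) : Set where
      constructor mk~
      field
        e  : ℕ
        eq : p ^ e * a ≅ b [ r ]

    ~-refl : ∀ {a} → a ~ a
    ~-refl {a} = mk~ 0 (≡⇒≅ (*-identityˡ a))

    ~-trans : ∀ {a b c} → a ~ b → b ~ c → a ~ c
    ~-trans {a} {b} {c} (mk~ e a~b) (mk~ e′ b~c) = mk~ (e′ + e) (begin
      p ^ (e′ + e) * a       ≡⟨ cong (_* a) (^-distribˡ-+-* p e′ e) ⟩
      p ^ e′ * p ^ e * a     ≡⟨ *-assoc (p ^ e′) (p ^ e) a ⟩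
      p ^ e′ * (p ^ e * a)   ≈⟨ ≅-*-cong (≅-refl {p ^ e′}) a~b ⟩
      p ^ e′ * b             ≈⟨ b~c ⟩
      c                      ∎)
      where open ≅-Reasoning r

    -- Modulo N, and hence modulo r, the inverse of p^e is p^(e (f - 1)).
    ~-sym : ∀ {a b} → a ~ b → b ~ a
    ~-sym {a} {b} (mk~ e a~b) = mk~ (e * pred f) (begin
      p ^ (e * pred f) * b             ≈⟨ ≅-*-cong (≅-refl {p ^ (e * pred f)}) a~b ⟨
      p ^ (e * pred f) * (p ^ e * a)   ≡⟨ *-assoc (p ^ (e * pred f)) (p ^ e) a ⟨
      p ^ (e * pred f) * p ^ e * a     ≡⟨ cong (_* a) (^-distribˡ-+-* p (e * pred f) e) ⟨
      p ^ (e * pred f + e) * a         ≡⟨ cong (λ x → p ^ x * a) (trans (lemma e (pred f)) (cong (e *_) (suc-pred f))) ⟩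
      p ^ (e * f) * a                  ≈⟨ ≅-*-cong (≅-∣ r∣N (order-^* ord e)) (≅-refl {a}) ⟩
      1 * a                            ≡⟨ *-identityˡ a ⟩
      a                                ∎)
      where
      open ≅-Reasoning r
      lemma : ∀ e k → e * k + e ≡ e * suc k
      lemma = solve-∀

    -- Exponents count only mod f, which leaves a finite search for `_~?_`.
    ~-bounded : ∀ {a b} → a ~ b → ∃[ e ] p ^ toℕ {f} e * a % r ≡ b % r
    ~-bounded {a} {b} (mk~ e a~b) = fromℕ< (m%n<n e f) , ≅⇒%≡ (begin
      p ^ toℕ (fromℕ< (m%n<n e f)) * a   ≡⟨ cong (λ x → p ^ x * a) (Fin.toℕ-fromℕ< (m%n<n e f)) ⟩
      p ^ (e % f) * a                    ≈⟨ ≅-*-cong (≅-∣ r∣N (order-^% ord e)) (≅-refl {a}) ⟩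
      p ^ e * a                          ≈⟨ a~b ⟩
      b                                  ∎)
      where open ≅-Reasoning r

    _~?_ : ∀ a b → Dec (a ~ b)
    a ~? b = map′ (λ (e , eq) → mk~ (toℕ e) (%≡⇒≅ eq)) ~-bounded
      (Fin.any? λ e → p ^ toℕ {f} e * a % r ≟ b % r)

    ~-shift : ∀ a b e d → a * p ^ e ≅ b * p ^ (e + d) [ r ] → p ^ d * b ≅ a [ r ]
    ~-shift a b e d eq = ≅-sym (≅-*-cancelˡ (p ^ e) (p^-coprime e p-coprime-r) (begin
      p ^ e * a             ≡⟨ *-comm (p ^ e) a ⟩
      a * p ^ e             ≈⟨ eq ⟩
      b * p ^ (e + d)       ≡⟨ cong (b *_) (^-distribˡ-+-* p e d) ⟩
      b * (p ^ e * p ^ d)   ≡⟨ lemma b (p ^ e) (p ^ d) ⟩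
      p ^ e * (p ^ d * b)   ∎))
      where
      open ≅-Reasoning r
      lemma : ∀ a b c → a * (b * c) ≡ b * (c * a)
      lemma = solve-∀

    -- As a is a unit mod r, p^d fixes it only if p^d ≡ 1, and `w′-minimal` excludes 0 < d < w′.
    fixed⇒≡ : ∀ {a e e′} d → r ∤ a → p ^ d * a ≅ a [ r ] → e + d ≡ e′ → e′ < w′ → e ≡ e′
    fixed⇒≡ {a} {e} {e′} d r∤a eq e+d≡e′ e′<w′ with d ≟ 0
    ... | yes refl = trans (sym (+-identityʳ e)) e+d≡e′
    ... | no  d≢0  = contradiction
      (≤-trans (w′-minimal d (n≢0⇒n>0 d≢0) p^d≅1) (subst (d ≤_) e+d≡e′ (m≤n+m d e))) (<⇒≱ e′<w′)
      where
      p^d≅1 : p ^ d ≅ 1 [ r ]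
      p^d≅1 = ≅-*-cancelˡ a (Coprimality.sym (prime∤⇒coprime r-prime r∤a))
        (≅-trans (≡⇒≅ (*-comm a (p ^ d))) (≅-trans eq (≡⇒≅ (sym (*-identityʳ a)))))

    val : Fin (r ∸ 1) → ℕ
    val i = suc (toℕ i)

    r∤val : ∀ i → r ∤ val i
    r∤val i = >⇒∤ (<-≤-trans (s<s (Fin.toℕ<n i)) (≤-reflexive (suc-pred r)))

    SameOrbit : Rel (Fin (r ∸ 1)) _
    SameOrbit i k = val i ~ val k

    orbits : DecSetoid _ _
    orbits = record
      { Carrier = Fin (r ∸ 1)
      ; _≈_     = SameOrbit
      ; isDecEquivalence = record
        { isEquivalence = record { refl = ~-refl ; sym = ~-sym ; trans = ~-trans }
        ; _≟_           = λ i k → val i ~? val k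
        }
      }

    -- Each orbit contains the w′ distinct points rep · pᵉ with e < w′, and r − 1 = w w′.
    length-unique-orbits : ∀ {xs} → AllPairs (λ x y → ¬ SameOrbit x y) xs → List.length xs ≤ w
    length-unique-orbits {xs} unique = *-cancelʳ-≤ k w w′ {{w′≢0}}
      (subst (k * w′ ≤_) r-1≡w*w′ (injective₂⇒*≤ (λ i e → toRes (point i e)) toRes-point-injective))
      where
      k = List.length xs
      w′≢0 : NonZero w′
      w′≢0 = ≢-nonZero λ w′≡0 → 1+n≰n (subst (1 ≤_) (trans r-1≡w*w′ (trans (cong (w *_) w′≡0) (*-zeroʳ w))) 1≤r-1)
      rep : Fin k → ℕ
      rep i = val (List.lookup xs i)
      point : Fin k → Fin w′ → ℕ
      point i e = rep i * p ^ toℕ e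
      r∤point : ∀ i e → r ∤ point i e
      r∤point i e = ∤-* (r∤val (List.lookup xs i)) (r∤p^ (toℕ e))
      -- Cancelling p^e puts both representatives into one orbit, so they coincide; then p^δ fixes
      -- this representative, which forces δ = 0.
      point-injective : ∀ i i′ e e′ → toℕ e ≤ toℕ e′ → point i e ≅ point i′ e′ [ r ] → i ≡ i′ × e ≡ e′
      point-injective i i′ e e′ e≤e′ eq = i≡i′ , Fin.toℕ-injective e≡e′
        where
        δ : ℕ
        δ = proj₁ (m≤n⇒∃[o]m+o≡n e≤e′)
        e+δ≡e′ : toℕ e + δ ≡ toℕ e′
        e+δ≡e′ = proj₂ (m≤n⇒∃[o]m+o≡n e≤e′)
        i′~i : p ^ δ * rep i′ ≅ rep i [ r ]
        i′~i = ~-shift (rep i) (rep i′) (toℕ e) δ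
          (≅-trans eq (≡⇒≅ (cong (λ x → rep i′ * p ^ x) (sym e+δ≡e′))))
        rep~ : rep i′ ~ rep i
        rep~ = mk~ δ i′~i
        i≡i′ : i ≡ i′
        i≡i′ = sym (allPairs⇒lookup-injective SameOrbit ~-sym {xs} unique i′ i rep~)
        e≡e′ : toℕ e ≡ toℕ e′
        e≡e′ = fixed⇒≡ δ (r∤val (List.lookup xs i)) (subst (λ k → p ^ δ * rep k ≅ rep i [ r ]) (sym i≡i′) i′~i)
          e+δ≡e′ (Fin.toℕ<n e′)
      toRes-point-injective : ∀ i i′ e e′ → toRes (point i e) ≡ toRes (point i′ e′) → i ≡ i′ × e ≡ e′
      toRes-point-injective i i′ e e′ eq = [ (λ e≤e′ → point-injective i i′ e e′ e≤e′ same)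
        , (λ e′≤e → map sym sym (point-injective i′ i e′ e e′≤e (≅-sym same))) ]′ (≤-total (toℕ e) (toℕ e′))
        where
        same : point i e ≅ point i′ e′ [ r ]
        same = toRes-≅ (r∤point i e) (r∤point i′ e′) eq

    abstract
      orbit-reps : List (Fin (r ∸ 1))
      orbit-reps = deduplicate (DecSetoid._≟_ orbits) (List.allFin (r ∸ 1))

      orbit-reps-cover : ∀ {b} → r ∤ b → Any (λ i → val i ~ b) orbit-reps
      orbit-reps-cover {b} r∤b = Any.deduplicate⁺ (DecSetoid._≟_ orbits) (λ k~i i~b → ~-trans k~i i~b)
        (Any.tabulate⁺ (toRes b) (mk~ 0 (≅-trans (≡⇒≅ (trans (*-identityˡ (val (toRes b)))
          (trans (cong suc (Fin.toℕ-fromℕ< (residue< b))) (suc-residue r∤b)))) (%-≅ b r))))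

      length-orbit-reps : List.length orbit-reps ≤ w
      length-orbit-reps = length-unique-orbits (Unique.deduplicate-! orbits (List.allFin (r ∸ 1)))

    reps : List ℕ
    reps = 0 ∷ List.map val orbit-reps

    length-reps : List.length reps ≤ w + 1
    length-reps = subst₂ _≤_ (cong suc (sym (length-map val orbit-reps))) (+-comm 1 w) (s≤s length-orbit-reps)

    reps-cover : ∀ b → Any (_~ b) reps
    reps-cover b with r ∣? b
    ... | yes r∣b = here (mk~ 0 (≅-sym (∣⇒≅0 r∣b)))
    ... | no  r∤b = there (Any.map⁺ (orbit-reps-cover r∤b))

module FiniteFieldGraphs where
  open import Defs
  open import Algebra.Apartness.Bundles using (HeytingField)
  import Algebra.Apartness.Properties.HeytingCommutativeRing as HeytingProperties
  open import Algebra.Bundles using (AbelianGroup; CommutativeRing; RawRing)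
  open import Algebra.Morphism.Structures using (IsRingMonomorphism)
  import Algebra.Morphism.RingMonomorphism as RingMonomorphism
  import Algebra.Properties.CommutativeMonoid.Sum as MonoidSum
  import Algebra.Properties.Ring as RingProperties
  import Algebra.Properties.Semiring.Exp as Exp
  import Algebra.Properties.Semiring.Mult as Mult
  import Algebra.Properties.Semiring.Sum as SemiringSum
  import Algebra.Solver.Ring.NaturalCoefficients.Default as SemiringSolver
  open import Algebra.Structures using (IsAbelianGroup; IsCommutativeRing)
  open import Data.Bool.Base using (Bool; true; false; if_then_else_)
  open import Data.Fin.Base as Fin using (Fin; toℕ)
  import Data.Fin.Permutation as Permutation
  import Data.Fin.Properties as Fin
  open import Data.List.Base as List using (List; []; _∷_)
  open import Data.List.Properties using (length-map)
  open import Data.List.Relation.Unary.Any as Any using (Any; here; there)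
  import Data.List.Relation.Unary.Any.Properties as Any
  open import Data.Nat.Base as ℕ using (ℕ; zero; suc; _≤_; z≤n; s≤s; _∸_; NonZero; _!; _%_; _/_)
  open import Data.Nat.Combinatorics using (_C_; nCn≡1; nCk≡n!/k![n-k]!; k![n∸k]!∣n!)
  open import Data.Nat.Coprimality using (Coprime)
  open import Data.Nat.DivMod
    using (m%n<n; m≡m%n+[m/n]*n; m/n*n≡m; m<n⇒m%n≡m; [m+kn]%n≡m%n; m∣n⇒o%n%m≡o%m; m<n*o⇒m/o<n)
  open import Data.Nat.Divisibility using (_∣_; divides; ∣1⇒≡1; >⇒∤; m∣m*n; m%n≡0⇒n∣m; ∣m+n∣m⇒∣n)
  open import Data.Nat.Primality using (Prime; ¬prime[0]; ¬prime[1]; euclidsLemma; prime⇒nonZero)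
  import Data.Nat.Properties as ℕ
  open import Data.Nat.Properties using (_!*_!≢0)
  open import Data.Product.Base using (∃-syntax; _×_; _,_; proj₁; proj₂)
  open import Data.Sum.Base using (inj₁; inj₂; [_,_]′)
  import Data.Vec.Base as Vec
  open import Function.Base using (_∘_; id)
  open import Function.Bundles using (mk⇔; Inverse)
  open import Function.Definitions using (Injective)
  open import Level using (_⊔_) renaming (suc to lsuc)
  open import Relation.Binary.PropositionalEquality as ≡ using (_≡_; _≢_)
  import Relation.Binary.Reasoning.Setoid as SetoidReasoning
  open import Relation.Nullary using (¬_; Dec; yes; no; contradiction; does)
  open import Relation.Nullary.Decidable using (does-⇔; dec-true; dec-false; map′)
  open Arithmetic

  -- Finite sums in a commutative ring

  module Sums {a ℓ} (R : CommutativeRing a ℓ) where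
    open CommutativeRing R hiding (zero)
    open RingProperties ring using (-0#≈0#)
    open SemiringSum semiring public
      using (sum; sum-cong-≋; sum-remove; sum-permute; sum-init-last; sum-replicate; sum-replicate-zero
            ; ∑-distrib-+; ∑-comm; *-distribˡ-sum; *-distribʳ-sum)

    infix 8 _when_

    _when_ : Carrier → Bool → Carrier
    x when b = if b then x else 0#

    when-cong : ∀ {x y} b → x ≈ y → x when b ≈ y when b
    when-cong false x≈y = refl
    when-cong true  x≈y = x≈y

    sum-zero : ∀ {n} {f : Fin n → Carrier} → (∀ i → f i ≈ 0#) → sum f ≈ 0#
    sum-zero {n} f≈0 = trans (sum-cong-≋ f≈0) (sum-replicate-zero n)

    sum-reindex : ∀ {n} (f : Fin n → Carrier) (β β⁻¹ : Fin n → Fin n) →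
                  (∀ i → β (β⁻¹ i) ≡ i) → (∀ i → β⁻¹ (β i) ≡ i) → sum f ≈ sum (f ∘ β)
    sum-reindex f β β⁻¹ invˡ invʳ = sum-permute f (Permutation.permutation β β⁻¹ invˡ invʳ)

    sum-single : ∀ {n} {f : Fin n → Carrier} j → (∀ i → i ≢ j → f i ≈ 0#) → sum f ≈ f j
    sum-single {suc n} {f} j f≈0 = trans (sum-remove {i = j} f)
      (trans (+-congˡ (sum-zero (λ i → f≈0 _ (Fin.punchInᵢ≢i j i)))) (+-identityʳ (f j)))

    -- The indicator of a disjoint union is the sum of the indicators: at most one summand survives.
    when-partition : ∀ {n p q} {P : Set p} {Q : Fin n → Set q} (P? : Dec P) (Q? : ∀ i → Dec (Q i)) →
      (P → ∃[ i ] Q i) → (∀ {i} → Q i → P) → (∀ {i k} → Q i → Q k → i ≡ k) →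
      ∀ y → y when does P? ≈ sum (λ i → y when does (Q? i))
    when-partition (yes p) Q? split join unique y with j , q ← split p =
      sym (trans (sum-single j (λ i i≢j → reflexive (≡.cong (y when_) (dec-false (Q? i) (λ qᵢ → i≢j (unique qᵢ q))))))
        (reflexive (≡.cong (y when_) (dec-true (Q? j) q))))
    when-partition (no ¬p) Q? split join unique y =
      sym (sum-zero (λ i → reflexive (≡.cong (y when_) (dec-false (Q? i) (λ qᵢ → ¬p (join qᵢ))))))

    sum-sub : ∀ {n} (f : Fin n → Carrier) → sum (λ i → - f i) ≈ - sum f
    sum-sub {zero}  f = sym -0#≈0#
    sum-sub {suc n} f = trans (+-congˡ (sum-sub (f ∘ Fin.suc))) (⁻¹-∙-comm (f Fin.zero) (sum (f ∘ Fin.suc)))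
      where open import Algebra.Properties.AbelianGroup +-abelianGroup using (⁻¹-∙-comm)

  -- Monic polynomial functions, written as iterated f(x) = (x − a) g(x) + c with varying centres a:
  -- products of linear factors are of this form, and so is the quotient by any further factor.
  module MonicFunctions {a ℓ} (R : CommutativeRing a ℓ) where
    open CommutativeRing R hiding (zero)
    open SetoidReasoning setoid

    data Monic : ℕ → (Carrier → Carrier) → Set (a ⊔ ℓ) where
      constant : ∀ {f} → (∀ x → f x ≈ 1#) → Monic 0 f
      step     : ∀ {n f g} a c → Monic n g → (∀ x → f x ≈ (x - a) * g x + c) → Monic (suc n) f

    telescope : ∀ x y z → x - z ≈ (x - y) + (y - z)
    telescope x y z = begin
      x - z                   ≈⟨ +-congʳ (+-identityʳ x) ⟨
      x + 0# - z              ≈⟨ +-congʳ (+-congˡ (-‿inverseˡ y)) ⟨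
      x + (- y + y) - z       ≈⟨ +-congʳ (+-assoc x (- y) y) ⟨
      (x - y) + y - z         ≈⟨ +-assoc (x - y) y (- z) ⟩
      (x - y) + (y - z)       ∎

    -- Divide g by x - y and split x - a as (x - y) + (y - a). The quotient (x - a) h(x) + g(y)
    -- keeps the centre a, so it is again of the monic form.
    factor : ∀ {n f} → Monic (suc n) f → ∀ y → ∃[ g ] Monic n g × (∀ x → f x ≈ (x - y) * g x + f y)
    factor {zero} {f} (step {g = g} a c monic@(constant g≈1) f≈) y = g , monic , λ x → begin
      f x                                        ≈⟨ f≈ x ⟩
      (x - a) * g x + c                          ≈⟨ +-congʳ (*-congʳ (telescope x y a)) ⟩
      ((x - y) + (y - a)) * g x + c              ≈⟨ +-congʳ (distribʳ (g x) (x - y) (y - a)) ⟩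
      (x - y) * g x + (y - a) * g x + c          ≈⟨ +-assoc ((x - y) * g x) ((y - a) * g x) c ⟩
      (x - y) * g x + ((y - a) * g x + c)        ≈⟨ +-congˡ (+-congʳ (*-congˡ (trans (g≈1 x) (sym (g≈1 y))))) ⟩
      (x - y) * g x + ((y - a) * g y + c)        ≈⟨ +-congˡ (f≈ y) ⟨
      (x - y) * g x + f y                        ∎
    factor {suc n} {f} (step {g = g} a c monic f≈) y with h , h-monic , g≈ ← factor monic y =
      (λ x → (x - a) * h x + g y) , step a (g y) h-monic (λ x → refl) , λ x → begin
        f x                                                             ≈⟨ f≈ x ⟩
        (x - a) * g x + c                                               ≈⟨ +-congʳ (*-cong (telescope x y a) (g≈ x)) ⟩
        ((x - y) + (y - a)) * ((x - y) * h x + g y) + c                 ≈⟨ lemma (x - y) (y - a) (h x) (g y) c ⟩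
        (x - y) * (((x - y) + (y - a)) * h x + g y) + ((y - a) * g y + c)
          ≈⟨ +-cong (*-congˡ (+-congʳ (*-congʳ (telescope x y a)))) (f≈ y) ⟨
        (x - y) * ((x - a) * h x + g y) + f y                           ∎
      where
      open SemiringSolver commutativeSemiring
      lemma : ∀ Y Z h G c → (Y + Z) * (Y * h + G) + c ≈ Y * ((Y + Z) * h + G) + (Z * G + c)
      lemma = solve 5 (λ Y Z h G c →
        (Y :+ Z) :* (Y :* h :+ G) :+ c := Y :* ((Y :+ Z) :* h :+ G) :+ (Z :* G :+ c)) refl

    -- Splitting off the first root leaves (xᵢ - x₀) g(xᵢ) = 0. The ring may have zero divisors, so
    -- `cancel` is what makes xᵢ a root of g. In degree 0 a root would give 1 = 0.
    roots≤degree : ∀ {m n f} → Monic n f → ¬ (1# ≈ 0#) → (x : Fin m → Carrier) → (∀ i → f (x i) ≈ 0#) →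
                   (∀ i j → i ≢ j → ∀ y → (x i - x j) * y ≈ 0# → y ≈ 0#) → m ≤ n
    roots≤degree {zero}  _ 1≉0 x fx≈0 cancel = z≤n
    roots≤degree {suc m} (constant f≈1) 1≉0 x fx≈0 cancel =
      contradiction (trans (sym (f≈1 (x Fin.zero))) (fx≈0 Fin.zero)) 1≉0
    roots≤degree {suc m} {suc n} {f} monic@(step _ _ _ _) 1≉0 x fx≈0 cancel
      with g , g-monic , f≈ ← factor monic (x Fin.zero) =
      s≤s (roots≤degree g-monic 1≉0 (x ∘ Fin.suc) (λ i → cancel (Fin.suc i) Fin.zero (λ ()) _ (begin
        (x (Fin.suc i) - x Fin.zero) * g (x (Fin.suc i))                     ≈⟨ +-identityʳ _ ⟨
        (x (Fin.suc i) - x Fin.zero) * g (x (Fin.suc i)) + 0#                ≈⟨ +-congˡ (fx≈0 Fin.zero) ⟨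
        (x (Fin.suc i) - x Fin.zero) * g (x (Fin.suc i)) + f (x Fin.zero)    ≈⟨ f≈ (x (Fin.suc i)) ⟨
        f (x (Fin.suc i))                                                    ≈⟨ fx≈0 (Fin.suc i) ⟩
        0#                                                                   ∎))
        (λ i j i≢j → cancel (Fin.suc i) (Fin.suc j) (i≢j ∘ Fin.suc-injective)))

    linearFactors : List Carrier → Carrier → Carrier
    linearFactors as x = List.foldr (λ a y → (x - a) * y) 1# as

    linearFactors-monic : ∀ as → Monic (List.length as) (linearFactors as)
    linearFactors-monic []       = constant (λ x → refl)
    linearFactors-monic (a ∷ as) = step a 0# (linearFactors-monic as) (λ x → sym (+-identityʳ _))

    linearFactors-annihilates : ∀ {as} x y → Any (λ a → (x - a) * y ≈ 0#) as → linearFactors as x * y ≈ 0#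
    linearFactors-annihilates {a ∷ as} x y (here [x-a]y≈0) = begin
      (x - a) * linearFactors as x * y   ≈⟨ *-congʳ (*-comm (x - a) (linearFactors as x)) ⟩
      linearFactors as x * (x - a) * y   ≈⟨ *-assoc (linearFactors as x) (x - a) y ⟩
      linearFactors as x * ((x - a) * y) ≈⟨ *-congˡ [x-a]y≈0 ⟩
      linearFactors as x * 0#            ≈⟨ zeroʳ (linearFactors as x) ⟩
      0#                                 ∎
    linearFactors-annihilates {a ∷ as} x y (there annihilates) = begin
      (x - a) * linearFactors as x * y   ≈⟨ *-assoc (x - a) (linearFactors as x) y ⟩
      (x - a) * (linearFactors as x * y) ≈⟨ *-congˡ (linearFactors-annihilates x y annihilates) ⟩
      (x - a) * 0#                       ≈⟨ zeroʳ (x - a) ⟩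
      0#                                 ∎

  -- Quotients by annihilators

  module RingModuloAnnihilator {a ℓ i} (R : CommutativeRing a ℓ) {I : Set i} (z : I → CommutativeRing.Carrier R) where
    open CommutativeRing R
    open RingProperties ring using (-‿distribʳ-*)

    infix 4 _≈ᶻ_

    -- Congruence modulo the common annihilator of all `z k`: a relation holds in the quotient once
    -- multiplication by each `z k` makes it true.
    _≈ᶻ_ : Carrier → Carrier → Set (i ⊔ ℓ)
    x ≈ᶻ y = ∀ k → z k * x ≈ z k * y

    ≈⇒≈ᶻ : ∀ {x y} → x ≈ y → x ≈ᶻ y
    ≈⇒≈ᶻ x≈y k = *-congˡ x≈y

    quotient : CommutativeRing a (i ⊔ ℓ)
    quotient = record
      { Carrier = Carrier ; _≈_ = _≈ᶻ_ ; _+_ = _+_ ; _*_ = _*_ ; -_ = -_ ; 0# = 0# ; 1# = 1#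
      ; isCommutativeRing = record
        { isRing = record
          { +-isAbelianGroup = record
            { isGroup = record
              { isMonoid = record
                { isSemigroup = record
                  { isMagma = record
                    { isEquivalence = record
                      { refl  = λ k → refl
                      ; sym   = λ x≈y k → sym (x≈y k)
                      ; trans = λ x≈y y≈z k → trans (x≈y k) (y≈z k)
                      }
                    ; ∙-cong = λ {x} {y} {u} {v} x≈y u≈v k →
                        trans (distribˡ (z k) x u) (trans (+-cong (x≈y k) (u≈v k)) (sym (distribˡ (z k) y v)))
                    }
                  ; assoc = λ x y w → ≈⇒≈ᶻ (+-assoc x y w)
                  }
                ; identity = (λ x → ≈⇒≈ᶻ (+-identityˡ x)) , (λ x → ≈⇒≈ᶻ (+-identityʳ x))
                }
              ; inverse = (λ x → ≈⇒≈ᶻ (-‿inverseˡ x)) , (λ x → ≈⇒≈ᶻ (-‿inverseʳ x))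
              ; ⁻¹-cong = λ {x} {y} x≈y k →
                  trans (sym (-‿distribʳ-* (z k) x)) (trans (-‿cong (x≈y k)) (-‿distribʳ-* (z k) y))
              }
            ; comm = λ x y → ≈⇒≈ᶻ (+-comm x y)
            }
          ; *-cong = λ {x} {y} {u} {v} x≈y u≈v k →
              trans (sym (*-assoc (z k) x u)) (trans (*-congʳ (x≈y k)) (trans (*-assoc (z k) y u)
              (trans (*-congˡ (*-comm y u)) (trans (sym (*-assoc (z k) u y)) (trans (*-congʳ (u≈v k))
              (trans (*-assoc (z k) v y) (*-congˡ (*-comm v y))))))))
          ; *-assoc = λ x y w → ≈⇒≈ᶻ (*-assoc x y w)
          ; *-identity = (λ x → ≈⇒≈ᶻ (*-identityˡ x)) , (λ x → ≈⇒≈ᶻ (*-identityʳ x))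
          ; distrib = (λ x y w → ≈⇒≈ᶻ (distribˡ x y w)) , (λ x y w → ≈⇒≈ᶻ (distribʳ x y w))
          }
        ; *-comm = λ x y → ≈⇒≈ᶻ (*-comm x y)
        }
      }

  -- The convolution algebra of a finite abelian group

  module GroupAlgebra {a ℓ} (K : CommutativeRing a ℓ) {n : ℕ}
    (_⊕_ : Fin n → Fin n → Fin n) (0ᴳ : Fin n) (neg : Fin n → Fin n)
    (isAbelianGroup : IsAbelianGroup _≡_ _⊕_ 0ᴳ neg)
    where

    open CommutativeRing K hiding (zero)
    open Sums K
    open SetoidReasoning setoid

    G : AbelianGroup _ _
    G = record { isAbelianGroup = isAbelianGroup }

    module G where
      open AbelianGroup G public
      open import Algebra.Properties.AbelianGroup G public

    infixl 6 _⊖_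
    infixl 7 _⋆_

    _⊖_ : Fin n → Fin n → Fin n
    x ⊖ y = x ⊕ neg y

    ⊖-⊕ : ∀ x y → (x ⊖ y) ⊕ y ≡ x
    ⊖-⊕ x y = G.//-rightDividesˡ y x

    ⊕-⊖ : ∀ x y → (x ⊕ y) ⊖ y ≡ x
    ⊕-⊖ x y = G.//-rightDividesʳ y x

    x⊖[x⊖y] : ∀ x y → x ⊖ (x ⊖ y) ≡ y
    x⊖[x⊖y] x y = ≡.trans (≡.cong (_⊖ (x ⊖ y)) (≡.trans (≡.sym (⊖-⊕ x y)) (G.comm (x ⊖ y) y))) (⊕-⊖ y (x ⊖ y))

    x⊖[y⊕z] : ∀ x y z → x ⊖ (y ⊕ z) ≡ (x ⊖ z) ⊖ y
    x⊖[y⊕z] x y z = ≡.trans (≡.cong (x ⊕_) (≡.trans (≡.sym (G.⁻¹-∙-comm y z)) (G.comm (neg y) (neg z))))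
      (≡.sym (G.assoc x (neg z) (neg y)))

    ∑-⊕ : ∀ (f : Fin n → Carrier) x → sum f ≈ sum (λ y → f (y ⊕ x))
    ∑-⊕ f x = sum-reindex f (_⊕ x) (_⊖ x) (λ y → ⊖-⊕ y x) (λ y → ⊕-⊖ y x)

    ∑-⊖ : ∀ (f : Fin n → Carrier) x → sum f ≈ sum (λ y → f (x ⊖ y))
    ∑-⊖ f x = sum-reindex f (x ⊖_) (x ⊖_) (x⊖[x⊖y] x) (x⊖[x⊖y] x)

    Element : Set a
    Element = Fin n → Carrier

    _⋆_ : Element → Element → Element
    (u ⋆ v) x = sum λ y → u y * v (x ⊖ y)

    [_] : Fin n → Element
    [ x ] y = 1# when does (y Fin.≟ x)

    ⋆-cong : ∀ {u u′ v v′ : Element} → (∀ x → u x ≈ u′ x) → (∀ x → v x ≈ v′ x) → ∀ x → (u ⋆ v) x ≈ (u′ ⋆ v′) x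
    ⋆-cong u≈u′ v≈v′ x = sum-cong-≋ λ y → *-cong (u≈u′ y) (v≈v′ (x ⊖ y))

    ⋆-comm : ∀ u v x → (u ⋆ v) x ≈ (v ⋆ u) x
    ⋆-comm u v x = begin
      sum (λ y → u y * v (x ⊖ y))                 ≈⟨ ∑-⊖ (λ y → u y * v (x ⊖ y)) x ⟩
      sum (λ y → u (x ⊖ y) * v (x ⊖ (x ⊖ y)))     ≈⟨ sum-cong-≋ (λ y → trans (*-congˡ (reflexive (≡.cong v (x⊖[x⊖y] x y)))) (*-comm _ _)) ⟩
      sum (λ y → v y * u (x ⊖ y))                 ∎

    ⋆-assoc : ∀ u v w x → ((u ⋆ v) ⋆ w) x ≈ (u ⋆ (v ⋆ w)) x
    ⋆-assoc u v w x = begin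
      sum (λ y → sum (λ k → u k * v (y ⊖ k)) * w (x ⊖ y))
        ≈⟨ sum-cong-≋ (λ y → *-distribʳ-sum (w (x ⊖ y)) (λ k → u k * v (y ⊖ k))) ⟩
      sum (λ y → sum (λ k → u k * v (y ⊖ k) * w (x ⊖ y)))
        ≈⟨ ∑-comm (λ y k → u k * v (y ⊖ k) * w (x ⊖ y)) ⟩
      sum (λ k → sum (λ y → u k * v (y ⊖ k) * w (x ⊖ y)))
        ≈⟨ sum-cong-≋ (λ k → inner k) ⟩
      sum (λ k → u k * sum (λ y → v y * w ((x ⊖ k) ⊖ y)))   ∎
      where
      inner : ∀ k → sum (λ y → u k * v (y ⊖ k) * w (x ⊖ y)) ≈ u k * sum (λ y → v y * w ((x ⊖ k) ⊖ y))
      inner k = begin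
        sum (λ y → u k * v (y ⊖ k) * w (x ⊖ y))               ≈⟨ ∑-⊕ (λ y → u k * v (y ⊖ k) * w (x ⊖ y)) k ⟩
        sum (λ y → u k * v ((y ⊕ k) ⊖ k) * w (x ⊖ (y ⊕ k)))   ≈⟨ sum-cong-≋ (λ y → trans (*-assoc _ _ _)
          (*-congˡ (reflexive (≡.cong₂ (λ s t → v s * w t) (⊕-⊖ y k) (x⊖[y⊕z] x y k))))) ⟩
        sum (λ y → u k * (v y * w ((x ⊖ k) ⊖ y)))             ≈⟨ *-distribˡ-sum (u k) (λ y → v y * w ((x ⊖ k) ⊖ y)) ⟨
        u k * sum (λ y → v y * w ((x ⊖ k) ⊖ y))               ∎

    ⋆-distribˡ : ∀ u v w x → (u ⋆ (λ y → v y + w y)) x ≈ (u ⋆ v) x + (u ⋆ w) x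
    ⋆-distribˡ u v w x = trans (sum-cong-≋ (λ y → distribˡ (u y) (v (x ⊖ y)) (w (x ⊖ y))))
      (∑-distrib-+ (λ y → u y * v (x ⊖ y)) (λ y → u y * w (x ⊖ y)))

    []-off : ∀ {x y} → y ≢ x → [ x ] y ≈ 0#
    []-off {x} {y} y≢x with y Fin.≟ x
    ... | yes y≡x = contradiction y≡x y≢x
    ... | no  _   = refl

    []-on : ∀ x → [ x ] x ≈ 1#
    []-on x with x Fin.≟ x
    ... | yes _  = refl
    ... | no x≢x = contradiction ≡.refl x≢x

    []-⇔ : ∀ {x y x′ y′} → (y ≡ x → y′ ≡ x′) → (y′ ≡ x′ → y ≡ x) → [ x ] y ≈ [ x′ ] y′
    []-⇔ {x} {y} {x′} {y′} f g = reflexive (≡.cong (1# when_) (does-⇔ (mk⇔ f g) (y Fin.≟ x) (y′ Fin.≟ x′)))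

    scaled-[]-⋆ : ∀ k g v x → ((λ y → k * [ g ] y) ⋆ v) x ≈ k * v (x ⊖ g)
    scaled-[]-⋆ k g v x = begin
      sum (λ y → k * [ g ] y * v (x ⊖ y))   ≈⟨ sum-single g (λ y y≢g → trans (*-congʳ (trans (*-congˡ ([]-off y≢g)) (zeroʳ k))) (zeroˡ _)) ⟩
      k * [ g ] g * v (x ⊖ g)               ≈⟨ *-congʳ (trans (*-congˡ ([]-on g)) (*-identityʳ k)) ⟩
      k * v (x ⊖ g)                         ∎

    []-⋆ : ∀ g v x → ([ g ] ⋆ v) x ≈ v (x ⊖ g)
    []-⋆ g v x = trans (⋆-cong {v = v} (λ y → sym (*-identityˡ ([ g ] y))) (λ _ → refl) x)
      (trans (scaled-[]-⋆ 1# g v x) (*-identityˡ _))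

    x⊖0 : ∀ x → x ⊖ 0ᴳ ≡ x
    x⊖0 x = ≡.trans (≡.cong (x ⊕_) G.ε⁻¹≈ε) (G.identityʳ x)

    ⋆-identityˡ : ∀ v x → ([ 0ᴳ ] ⋆ v) x ≈ v x
    ⋆-identityˡ v x = trans ([]-⋆ 0ᴳ v x) (reflexive (≡.cong v (x⊖0 x)))

    groupAlgebra : CommutativeRing a ℓ
    groupAlgebra = record
      { Carrier = Element ; _≈_ = λ u v → ∀ x → u x ≈ v x
      ; _+_ = λ u v x → u x + v x ; _*_ = _⋆_ ; -_ = λ u x → - u x ; 0# = λ _ → 0# ; 1# = [ 0ᴳ ]
      ; isCommutativeRing = record
        { isRing = record
          { +-isAbelianGroup = record
            { isGroup = record
              { isMonoid = record
                { isSemigroup = record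
                  { isMagma = record
                    { isEquivalence = record
                      { refl  = λ x → refl
                      ; sym   = λ u≈v x → sym (u≈v x)
                      ; trans = λ u≈v v≈w x → trans (u≈v x) (v≈w x)
                      }
                    ; ∙-cong = λ u≈v w≈t x → +-cong (u≈v x) (w≈t x)
                    }
                  ; assoc = λ u v w x → +-assoc (u x) (v x) (w x)
                  }
                ; identity = (λ u x → +-identityˡ (u x)) , (λ u x → +-identityʳ (u x))
                }
              ; inverse = (λ u x → -‿inverseˡ (u x)) , (λ u x → -‿inverseʳ (u x))
              ; ⁻¹-cong = λ u≈v x → -‿cong (u≈v x)
              }
            ; comm = λ u v x → +-comm (u x) (v x)
            }
          ; *-cong = λ {u} {u′} {v} {v′} → ⋆-cong {u} {u′} {v} {v′}
          ; *-assoc = ⋆-assoc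
          ; *-identity = ⋆-identityˡ , (λ u x → trans (⋆-comm u [ 0ᴳ ] x) (⋆-identityˡ u x))
          ; distrib = ⋆-distribˡ , (λ u v w x → trans (⋆-comm (λ y → v y + w y) u x)
              (trans (⋆-distribˡ u v w x) (+-cong (⋆-comm u v x) (⋆-comm u w x))))
          }
        ; *-comm = ⋆-comm
        }
      }

    sum-apply : ∀ {m} (u : Fin m → Element) x → Sums.sum groupAlgebra u x ≈ sum (λ i → u i x)
    sum-apply {zero}  u x = refl
    sum-apply {suc m} u x = +-congˡ (sum-apply (u ∘ Fin.suc) x)

    []-⊕ : ∀ g h x → [ g ⊕ h ] x ≈ ([ g ] ⋆ [ h ]) x
    []-⊕ g h x = trans ([]-⇔
      (λ x≡g⊕h → ≡.trans (≡.cong (_⊖ g) (≡.trans x≡g⊕h (G.comm g h))) (⊕-⊖ h g))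
      (λ x⊖g≡h → ≡.trans (≡.sym (⊖-⊕ x g)) (≡.trans (≡.cong (_⊕ g) x⊖g≡h) (G.comm h g))))
      (sym ([]-⋆ g [ h ] x))

    ι : Carrier → Element
    ι k x = k * [ 0ᴳ ] x

    ι-⋆ : ∀ k v x → (ι k ⋆ v) x ≈ k * v x
    ι-⋆ k v x = trans (scaled-[]-⋆ k 0ᴳ v x) (*-congˡ (reflexive (≡.cong v (x⊖0 x))))

  -- A ring with a nontrivial invariant additive character

  -- What a Heyting field of characteristic zero still offers when apartness is replaced by mere
  -- inequality: an element different from 0 need not be invertible, but it can be cancelled.
  record IsCharacterDomain {a ℓ} (K : CommutativeRing a ℓ) : Set (a ⊔ ℓ) where
    open CommutativeRing K
    open Mult semiring using () renaming (_×_ to _·_)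
    field
      stable   : ∀ {x y} → ¬ ¬ (x ≈ y) → x ≈ y
      cancel   : ∀ {x y} → ¬ (x ≈ 0#) → x * y ≈ 0# → y ≈ 0#
      charZero : ∀ n → ¬ (suc n · 1# ≈ 0#)

  -- A ring containing K in which the additive group has a nontrivial σ-invariant character ψ.
  -- It replaces K(ζₚ), which need not be available as a field.
  record CharacterRing {a ℓ} (K : CommutativeRing a ℓ) {n : ℕ}
    (_⊕_ : Fin n → Fin n → Fin n) (0ᴳ : Fin n) (σ : Fin n → Fin n) : Set (lsuc (a ⊔ ℓ)) where
    private
      module K = CommutativeRing K
    field
      L : CommutativeRing a ℓ
    open CommutativeRing L public hiding (zero)
    open Sums L public
    field
      ι        : K.Carrier → Carrier
      ι-cong   : ∀ {x y} → x K.≈ y → ι x ≈ ι y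
      ι-+      : ∀ x y → ι (x K.+ y) ≈ ι x + ι y
      ι-*      : ∀ x y → ι (x K.* y) ≈ ι x * ι y
      ι-neg    : ∀ x → ι (K.- x) ≈ - ι x
      ι-0      : ι K.0# ≈ 0#
      ι-1      : ι K.1# ≈ 1#
      ι-cancel : ∀ {x y} → ¬ (x K.≈ K.0#) → ι x * y ≈ 0# → y ≈ 0#
      ψ        : Fin n → Carrier
      ψ-⊕      : ∀ x y → ψ (x ⊕ y) ≈ ψ x * ψ y
      ψ-0      : ψ 0ᴳ ≈ 1#
      ψ-σ      : ∀ x → ψ (σ x) ≈ ψ x
      ∑ψ≈0     : sum ψ ≈ 0#
      1≉0      : ¬ (1# ≈ 0#)
      stable   : ∀ {x y} → ¬ ¬ (x ≈ y) → x ≈ y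

  -- A section of f is injective, hence surjective on a finite set, and thus a two-sided inverse of
  -- f.
  surjective⇒injective : ∀ {n} (f : Fin n → Fin n) → (∀ y → ∃[ x ] f x ≡ y) → ∀ {x y} → f x ≡ f y → x ≡ y
  surjective⇒injective f f-surj {x} {y} fx≡fy = begin
    x             ≡⟨ proj₂ (s-surj x) ⟨
    s (t x)       ≡⟨ ≡.cong s (tx≡ x) ⟩
    s (f x)       ≡⟨ ≡.cong s fx≡fy ⟩
    s (f y)       ≡⟨ ≡.cong s (tx≡ y) ⟨
    s (t y)       ≡⟨ proj₂ (s-surj y) ⟩
    y             ∎
    where
    open ≡.≡-Reasoning
    s : _ → _
    s y = proj₁ (f-surj y)
    s-surj : ∀ x → ∃[ y ] s y ≡ x
    s-surj = injective⇒surjective s λ {y} {y′} eq → ≡.trans (≡.sym (proj₂ (f-surj y)))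
      (≡.trans (≡.cong f eq) (proj₂ (f-surj y′)))
    t : _ → _
    t x = proj₁ (s-surj x)
    tx≡ : ∀ x → t x ≡ f x
    tx≡ x = ≡.trans (≡.sym (proj₂ (f-surj (t x)))) (≡.cong f (proj₂ (s-surj x)))

  -- ψ x is the class of the group element x in the group algebra modulo the relations [σ x] = [x]
  -- and Σₓ [x] = 0; this quotient is nonzero because x ↦ σ x − x is not surjective.
  module Construction {a ℓ} (K : CommutativeRing a ℓ) (K-domain : IsCharacterDomain K) {n : ℕ}
    (_⊕_ : Fin n → Fin n → Fin n) (0ᴳ : Fin n) (neg : Fin n → Fin n)
    (isAbelianGroup : IsAbelianGroup _≡_ _⊕_ 0ᴳ neg)
    (σ : Fin n → Fin n) (σ-⊕ : ∀ x y → σ (x ⊕ y) ≡ σ x ⊕ σ y)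
    (e : Fin n) (e≢0 : e ≢ 0ᴳ) (σe≡e : σ e ≡ e)
    where

    open CommutativeRing K hiding (zero)
    open IsCharacterDomain K-domain
    open RingProperties ring using (-‿distribˡ-*; x∙y⁻¹≈ε⇒x≈y; -0#≈0#)
    open Mult semiring using () renaming (_×_ to _·_)
    open Sums K
    open GroupAlgebra K _⊕_ 0ᴳ neg isAbelianGroup
    open SetoidReasoning setoid
    private
      module A = CommutativeRing groupAlgebra

    ∂ : Fin n → Fin n
    ∂ x = σ x ⊖ x

    ∂-⊕ : ∀ x y → ∂ (x ⊕ y) ≡ ∂ x ⊕ ∂ y
    ∂-⊕ x y = ≡.trans (≡.cong₂ _⊕_ (σ-⊕ x y) (≡.sym (G.⁻¹-∙-comm x y))) (interchange (σ x) (σ y) (neg x) (neg y))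
      where open import Algebra.Properties.CommutativeSemigroup G.commutativeSemigroup using (interchange)

    σ0≡0 : σ 0ᴳ ≡ 0ᴳ
    σ0≡0 = G.identityʳ-unique (σ 0ᴳ) (σ 0ᴳ) (≡.trans (≡.sym (σ-⊕ 0ᴳ 0ᴳ)) (≡.cong σ (G.identityʳ 0ᴳ)))

    ∂0≡∂e : ∂ 0ᴳ ≡ ∂ e
    ∂0≡∂e = ≡.trans (≡.trans (≡.cong (_⊖ 0ᴳ) σ0≡0) (G.inverseʳ 0ᴳ))
      (≡.sym (≡.trans (≡.cong (_⊖ e) σe≡e) (G.inverseʳ e)))

    -- As ∂ is additive, this is the sum of the elements of its image, each counted once for every
    -- element of the kernel; translations by the image fix it.
    E : Element
    E x = sum λ y → [ ∂ y ] x

    E-shift : ∀ x g → E (g ⊖ ∂ x) ≈ E g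
    E-shift x g = begin
      sum (λ y → [ ∂ y ] (g ⊖ ∂ x))      ≈⟨ sum-cong-≋ (λ y → []-⇔
        (λ eq → ≡.trans (≡.sym (⊖-⊕ g (∂ x))) (≡.trans (≡.cong (_⊕ ∂ x) eq) (≡.sym (∂-⊕ y x))))
        (λ eq → ≡.trans (≡.cong (_⊖ ∂ x) (≡.trans eq (∂-⊕ y x))) (⊕-⊖ (∂ y) (∂ x)))) ⟩
      sum (λ y → [ ∂ (y ⊕ x) ] g)        ≈⟨ ∑-⊕ (λ y → [ ∂ y ] g) x ⟨
      sum (λ y → [ ∂ y ] g)              ∎

    -- This is (1 - [g]) E. The factor E annihilates [σ x] - [x] = [x] ([∂ x] - 1), and 1 - [g]
    -- annihilates the sum of the whole group. All g are taken because z g vanishes for g in the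
    -- image of ∂.
    z : Fin n → Element
    z g x = E x - E (x ⊖ g)

    open RingModuloAnnihilator groupAlgebra z

    z-shift : ∀ k x g → z k (g ⊖ ∂ x) ≈ z k g
    z-shift k x g = +-cong (E-shift x g) (-‿cong (trans (reflexive (≡.cong E swap)) (E-shift x (g ⊖ k))))
      where
      swap : (g ⊖ ∂ x) ⊖ k ≡ (g ⊖ k) ⊖ ∂ x
      swap = ≡.trans (G.assoc g _ _) (≡.trans (≡.cong (g ⊕_) (G.comm _ _)) (≡.sym (G.assoc g _ _)))

    ⋆-[] : ∀ u g x → (u ⋆ [ g ]) x ≈ u (x ⊖ g)
    ⋆-[] u g x = trans (⋆-comm u [ g ] x) ([]-⋆ g u x)

    []-σ : ∀ x → [ σ x ] ≈ᶻ [ x ]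
    []-σ x k g = begin
      (z k ⋆ [ σ x ]) g          ≈⟨ ⋆-[] (z k) (σ x) g ⟩
      z k (g ⊖ σ x)              ≈⟨ reflexive (≡.cong (λ s → z k (g ⊖ s)) (≡.sym (⊖-⊕ (σ x) x))) ⟩
      z k (g ⊖ (∂ x ⊕ x))        ≈⟨ reflexive (≡.cong (z k) (x⊖[y⊕z] g (∂ x) x)) ⟩
      z k ((g ⊖ x) ⊖ ∂ x)        ≈⟨ z-shift k x (g ⊖ x) ⟩
      z k (g ⊖ x)                ≈⟨ ⋆-[] (z k) x g ⟨
      (z k ⋆ [ x ]) g            ∎

    z-sum : ∀ k → sum (z k) ≈ 0#
    z-sum k = begin
      sum (λ x → E x - E (x ⊖ k))              ≈⟨ ∑-distrib-+ E (λ x → - E (x ⊖ k)) ⟩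
      sum E + sum (λ x → - E (x ⊖ k))          ≈⟨ +-congˡ (sum-sub (λ x → E (x ⊖ k))) ⟩
      sum E - sum (λ x → E (x ⊖ k))            ≈⟨ +-congʳ (sum-reindex E (_⊖ k) (_⊕ k) (λ x → ⊕-⊖ x k) (λ x → ⊖-⊕ x k)) ⟩
      sum (λ x → E (x ⊖ k)) - sum (λ x → E (x ⊖ k))  ≈⟨ -‿inverseʳ _ ⟩
      0#                                       ∎

    ∑[]≈0 : Sums.sum groupAlgebra [_] ≈ᶻ A.0#
    ∑[]≈0 k g = begin
      sum (λ y → z k y * Sums.sum groupAlgebra [_] (g ⊖ y))   ≈⟨ sum-cong-≋ (λ y → trans (*-congˡ (ones (g ⊖ y))) (*-identityʳ _)) ⟩
      sum (z k)                                               ≈⟨ z-sum k ⟩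
      0#                                                      ≈⟨ A.zeroʳ (z k) g ⟨
      (z k ⋆ A.0#) g                                          ∎
      where
      ones : ∀ x → Sums.sum groupAlgebra [_] x ≈ 1#
      ones x = trans (sum-apply [_] x) (trans (sum-single x (λ y y≢x → []-off (y≢x ∘ ≡.sym))) ([]-on x))

    count× : ∀ {m} (b : Fin m → Bool) → ∃[ k ] sum (λ i → 1# when b i) ≈ k · 1#
    count× {zero}  b = 0 , refl
    count× {suc m} b with b Fin.zero | count× (b ∘ Fin.suc)
    ... | true  | k , eq = suc k , +-congˡ eq
    ... | false | k , eq = k , trans (+-identityˡ _) eq

    sum-when≉0 : ∀ {m} (b : Fin m → Bool) i → b i ≡ true → ¬ (sum (λ i → 1# when b i) ≈ 0#)
    sum-when≉0 {suc m} b Fin.zero b0 sum≈0 with b Fin.zero | count× (b ∘ Fin.suc)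
    ... | true | k , eq = charZero k (trans (+-congˡ (sym eq)) sum≈0)
    sum-when≉0 {suc m} b (Fin.suc i) bi sum≈0 with b Fin.zero | count× (b ∘ Fin.suc)
    ... | true  | k , eq = charZero k (trans (+-congˡ (sym eq)) sum≈0)
    ... | false | _      = sum-when≉0 (b ∘ Fin.suc) i bi (trans (sym (+-identityˡ _)) sum≈0)

    E∂0≉0 : ¬ (E (∂ 0ᴳ) ≈ 0#)
    E∂0≉0 = sum-when≉0 (λ y → does (∂ 0ᴳ Fin.≟ ∂ y)) 0ᴳ (dec-true (∂ 0ᴳ Fin.≟ ∂ 0ᴳ) ≡.refl)

    -- If 1 = 0, every z g vanishes and E is constant. Its value at ∂ 0 is a positive integer, so E
    -- vanishes nowhere and ∂ is surjective, hence injective; but ∂ sends both 0 and e to 0.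
    1≉ᶻ0 : ¬ (A.1# ≈ᶻ A.0#)
    1≉ᶻ0 1≈0 = e≢0 (surjective⇒injective ∂ ∂-surjective (≡.sym ∂0≡∂e))
      where
      E-constant : ∀ g → E (∂ 0ᴳ) ≈ E (∂ 0ᴳ ⊖ g)
      E-constant g = x∙y⁻¹≈ε⇒x≈y _ _ (begin
        z g (∂ 0ᴳ)             ≈⟨ A.*-identityʳ (z g) (∂ 0ᴳ) ⟨
        (z g ⋆ A.1#) (∂ 0ᴳ)    ≈⟨ 1≈0 g (∂ 0ᴳ) ⟩
        (z g ⋆ A.0#) (∂ 0ᴳ)    ≈⟨ A.zeroʳ (z g) (∂ 0ᴳ) ⟩
        0#                     ∎)
      E≉0 : ∀ g → ¬ (E g ≈ 0#)
      E≉0 g Eg≈0 = E∂0≉0 (trans (E-constant (∂ 0ᴳ ⊖ g)) (trans (reflexive (≡.cong E (x⊖[x⊖y] (∂ 0ᴳ) g))) Eg≈0))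
      ∂-surjective : ∀ g → ∃[ y ] ∂ y ≡ g
      ∂-surjective g with Fin.any? (λ y → ∂ y Fin.≟ g)
      ... | yes hit = hit
      ... | no miss = contradiction (sum-zero (λ y → []-off (λ g≡∂y → miss (y , ≡.sym g≡∂y)))) (E≉0 g)

    characterRing : CharacterRing K _⊕_ 0ᴳ σ
    characterRing = record
      { L        = quotient
      ; ι        = ι
      ; ι-cong   = λ x≈y → ≈⇒≈ᶻ (λ g → *-congʳ {[ 0ᴳ ] g} x≈y)
      ; ι-+      = λ x y → ≈⇒≈ᶻ (λ g → distribʳ ([ 0ᴳ ] g) x y)
      ; ι-*      = λ x y → ≈⇒≈ᶻ (λ g → trans (*-assoc x y ([ 0ᴳ ] g)) (sym (ι-⋆ x (ι y) g)))
      ; ι-neg    = λ x → ≈⇒≈ᶻ (λ g → sym (-‿distribˡ-* x ([ 0ᴳ ] g)))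
      ; ι-0      = ≈⇒≈ᶻ (λ g → zeroˡ ([ 0ᴳ ] g))
      ; ι-1      = ≈⇒≈ᶻ (λ g → *-identityˡ ([ 0ᴳ ] g))
      -- Multiplication by ι x scales each coefficient by x, so it passes through the product with z
      -- k and is cancelled coefficientwise in K.
      ; ι-cancel = λ {x} {y} x≉0 ιx*y≈0 k g → trans (cancel x≉0 (begin
          x * (z k ⋆ y) g          ≈⟨ ι-⋆ x (z k ⋆ y) g ⟨
          (ι x ⋆ (z k ⋆ y)) g      ≈⟨ A.*-assoc (ι x) (z k) y g ⟨
          ((ι x ⋆ z k) ⋆ y) g      ≈⟨ ⋆-cong {v = y} (⋆-comm (ι x) (z k)) (λ _ → refl) g ⟩
          ((z k ⋆ ι x) ⋆ y) g      ≈⟨ A.*-assoc (z k) (ι x) y g ⟩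
          (z k ⋆ (ι x ⋆ y)) g      ≈⟨ ιx*y≈0 k g ⟩
          (z k ⋆ A.0#) g           ≈⟨ A.zeroʳ (z k) g ⟩
          0#                       ∎)) (sym (A.zeroʳ (z k) g))
      ; ψ        = [_]
      ; ψ-⊕      = λ x y → ≈⇒≈ᶻ ([]-⊕ x y)
      ; ψ-0      = λ k g → refl
      ; ψ-σ      = []-σ
      ; ∑ψ≈0     = ∑[]≈0
      ; 1≉0      = 1≉ᶻ0
      ; stable   = λ ¬¬≈ k g → stable (λ ≉ → ¬¬≈ (λ ≈ᶻ → ≉ (≈ᶻ k g)))
      }

  -- Finite fields: Frobenius map, primitive element, cyclotomic classes

  prime∤! : ∀ {p} → Prime p → ∀ {k} → k ℕ.< p → ¬ (p ∣ k !)
  prime∤! p-prime {zero}  _    p∣1  = contradiction (≡.subst Prime (∣1⇒≡1 p∣1) p-prime) ¬prime[1]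
  prime∤! p-prime {suc k} k<p  p∣!  with euclidsLemma (suc k) (k !) p-prime p∣!
  ... | inj₁ p∣k+1 = >⇒∤ k<p p∣k+1
  ... | inj₂ p∣k!  = prime∤! p-prime (ℕ.<-trans (ℕ.n<1+n k) k<p) p∣k!

  nCk*k![n-k]!≡n! : ∀ {n k} → k ≤ n → (n C k) ℕ.* (k ! ℕ.* (n ∸ k) !) ≡ n !
  nCk*k![n-k]!≡n! {n} {k} k≤n = ≡.trans (≡.cong (ℕ._* (k ! ℕ.* (n ∸ k) !)) (nCk≡n!/k![n-k]! k≤n))
    (m/n*n≡m (k![n∸k]!∣n! k≤n))
    where instance _ = k !* (n ∸ k) !≢0

  -- p divides p! = C(p, k) k! (p - k)!, but neither of the two factorials k! and (p - k)!.
  prime∣C : ∀ {p} → Prime p → ∀ {k} → 1 ≤ k → k ℕ.< p → p ∣ p C k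
  prime∣C {p@(suc p′)} p-prime {k@(suc k′)} 1≤k k<p
    with euclidsLemma (p C k) (k ! ℕ.* (p ∸ k) !) p-prime
      (≡.subst (p ∣_) (≡.sym (nCk*k![n-k]!≡n! (ℕ.<⇒≤ k<p))) (m∣m*n (p′ !)))
  ... | inj₁ p∣C = p∣C
  ... | inj₂ p∣k!*[p-k]! with euclidsLemma (k !) ((p ∸ k) !) p-prime p∣k!*[p-k]!
  ...   | inj₁ p∣k!     = contradiction p∣k! (prime∤! p-prime k<p)
  ...   | inj₂ p∣[p-k]! = contradiction p∣[p-k]! (prime∤! p-prime (s≤s (ℕ.m∸n≤m p′ k′)))

  record FiniteField (q : ℕ) : Set where
    infixl 6 _+_
    infixl 7 _*_
    field
      _+_ _*_           : Fin q → Fin q → Fin q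
      -_                : Fin q → Fin q
      0# 1#             : Fin q
      isCommutativeRing : IsCommutativeRing _≡_ _+_ _*_ -_ 0# 1#
      1≢0               : 1# ≢ 0#
      inverse           : ∀ x → x ≢ 0# → ∃[ y ] y * x ≡ 1#

    R : CommutativeRing _ _
    R = record { isCommutativeRing = isCommutativeRing }

    module R = CommutativeRing R
    open Exp R.semiring public using (_^_)

    field
      γ         : Fin q
      γ≢0       : γ ≢ 0#
      generates : ∀ x → x ≢ 0# → ∃[ e ] x ≡ γ ^ e

  module FiniteFieldProperties {q : ℕ} (F : FiniteField q) where
    open FiniteField F
    open RingProperties R.ring using (-‿distribˡ-*; -‿distribʳ-*; -0#≈0#)
    open Mult R.semiring using (×1-homo-*; ×-assoc-*) renaming (_×_ to _·_)
    open Exp R.semiring using (^-homo-*; ^-assocʳ)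
    open import Algebra.Properties.CommutativeSemiring.Binomial R.commutativeSemiring
      using (binomialTerm) renaming (theorem to binomialTheorem)
    open Sums R
    open ≡.≡-Reasoning

    *-cancel-0 : ∀ {x y} → x ≢ 0# → x * y ≡ 0# → y ≡ 0#
    *-cancel-0 {x} {y} x≢0 xy≡0 with x⁻¹ , x⁻¹x≡1 ← inverse x x≢0 = begin
      y               ≡⟨ R.*-identityˡ y ⟨
      1# * y          ≡⟨ ≡.cong (_* y) x⁻¹x≡1 ⟨
      (x⁻¹ * x) * y   ≡⟨ R.*-assoc x⁻¹ x y ⟩
      x⁻¹ * (x * y)   ≡⟨ ≡.cong (x⁻¹ *_) xy≡0 ⟩
      x⁻¹ * 0#        ≡⟨ R.zeroʳ x⁻¹ ⟩
      0#              ∎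

    *-≢0 : ∀ {x y} → x ≢ 0# → y ≢ 0# → x * y ≢ 0#
    *-≢0 x≢0 y≢0 xy≡0 = y≢0 (*-cancel-0 x≢0 xy≡0)

    ^-≢0 : ∀ {x} → x ≢ 0# → ∀ e → x ^ e ≢ 0#
    ^-≢0 x≢0 zero    = 1≢0
    ^-≢0 x≢0 (suc e) = *-≢0 x≢0 (^-≢0 x≢0 e)

    ^-0 : ∀ {x} e → x ^ e ≡ 0# → x ≡ 0#
    ^-0 {x} e x^e≡0 with x Fin.≟ 0#
    ... | yes x≡0 = x≡0
    ... | no  x≢0 = contradiction x^e≡0 (^-≢0 x≢0 e)

    1^ : ∀ e → 1# ^ e ≡ 1#
    1^ zero    = ≡.refl
    1^ (suc e) = ≡.trans (R.*-identityˡ (1# ^ e)) (1^ e)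

    x-y≡0⇒x≡y : ∀ x y → x + (- y) ≡ 0# → x ≡ y
    x-y≡0⇒x≡y = x∙y⁻¹≈ε⇒x≈y
      where open import Algebra.Properties.Group R.+-group using (x∙y⁻¹≈ε⇒x≈y)

    -- Translating by 1 permutes the field, so the sum of all its elements is unchanged.
    q·1≡0 : q · 1# ≡ 0#
    q·1≡0 = ≡.trans (≡.sym (sum-replicate q)) (identityʳ-unique (sum {q} id) (sum {q} (λ _ → 1#)) (begin
      sum {q} id + sum {q} (λ _ → 1#)   ≡⟨ ∑-distrib-+ {q} id (λ _ → 1#) ⟨
      sum {q} (λ x → x + 1#)        ≡⟨ sum-reindex id (_+ 1#) (λ x → x + (- 1#)) (λ x → //-rightDividesˡ 1# x) (λ x → //-rightDividesʳ 1# x) ⟨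
      sum {q} id                    ∎))
      where open import Algebra.Properties.Group R.+-group using (identityʳ-unique; //-rightDividesˡ; //-rightDividesʳ)

    module Characteristic (p f : ℕ) (p-prime : Prime p) (q≡p^f : q ≡ p ℕ.^ f) where

      -- q · 1 is the f-th power of p · 1 and vanishes; the factors p · 1 are cancelled one at a
      -- time.
      p·1≡0 : p · 1# ≡ 0#
      p·1≡0 = go f (≡.subst (λ n → n · 1# ≡ 0#) q≡p^f q·1≡0)
        where
        go : ∀ f → (p ℕ.^ f) · 1# ≡ 0# → p · 1# ≡ 0#
        go zero    1·1≡0 = contradiction (≡.trans (≡.sym (R.+-identityʳ 1#)) 1·1≡0) 1≢0
        go (suc f) p^f≡0 with (p · 1#) Fin.≟ 0#
        ... | yes p·1≡0 = p·1≡0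
        ... | no  p·1≢0 = go f (*-cancel-0 p·1≢0 (≡.trans (≡.sym (×1-homo-* p (p ℕ.^ f))) p^f≡0))

      p∣⇒·≡0 : ∀ {k} x → p ∣ k → k · x ≡ 0#
      p∣⇒·≡0 x (divides m ≡.refl) = begin
        (m ℕ.* p) · x          ≡⟨ ≡.cong (λ y → (m ℕ.* p) · y) (R.*-identityˡ x) ⟨
        (m ℕ.* p) · (1# * x)   ≡⟨ ×-assoc-* (m ℕ.* p) 1# x ⟨
        ((m ℕ.* p) · 1#) * x   ≡⟨ ≡.cong (_* x) (×1-homo-* m p) ⟩
        ((m · 1#) * (p · 1#)) * x   ≡⟨ ≡.cong (λ y → ((m · 1#) * y) * x) p·1≡0 ⟩
        ((m · 1#) * 0#) * x    ≡⟨ ≡.cong (_* x) (R.zeroʳ (m · 1#)) ⟩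
        0# * x                 ≡⟨ R.zeroˡ x ⟩
        0#                     ∎

      frobenius-+ : ∀ x y → (x + y) ^ p ≡ (x ^ p) + (y ^ p)
      frobenius-+ x y = ≡.trans (binomialTheorem p x y) (go p-prime p∣⇒·≡0)
        where
        -- Generalising p allows it to be matched as a successor, which exposes the first and last
        -- binomial terms; all others carry a coefficient divisible by p.
        go : ∀ {p} → Prime p → (∀ {k} x → p ∣ k → k · x ≡ 0#) → sum (binomialTerm x y p) ≡ (x ^ p) + (y ^ p)
        go {zero}     p-prime _    = contradiction p-prime ¬prime[0]
        go {p@(suc p′)} p-prime p∣⇒ = begin
          t Fin.zero + sum (t ∘ Fin.suc)                            ≡⟨ ≡.cong (t Fin.zero +_) (sum-init-last (t ∘ Fin.suc)) ⟩
          t Fin.zero + (sum {p′} (λ i → t (Fin.suc (Fin.inject₁ i))) + t (Fin.suc (Fin.fromℕ p′)))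
            ≡⟨ ≡.cong₂ _+_ first (≡.cong₂ _+_ (sum-zero middle) last) ⟩
          (y ^ p) + (0# + (x ^ p))                                  ≡⟨ ≡.cong ((y ^ p) +_) (R.+-identityˡ (x ^ p)) ⟩
          (y ^ p) + (x ^ p)                                         ≡⟨ R.+-comm (y ^ p) (x ^ p) ⟩
          (x ^ p) + (y ^ p)                                         ∎
          where
          t : Fin (suc p) → Fin q
          t = binomialTerm x y p
          first : t Fin.zero ≡ y ^ p
          first = ≡.trans (R.+-identityʳ _) (R.*-identityˡ (y ^ p))
          middle : ∀ i → t (Fin.suc (Fin.inject₁ i)) ≡ 0#
          middle i = p∣⇒ _ (prime∣C p-prime (s≤s z≤n)
            (s≤s (≡.subst (ℕ._< p′) (≡.sym (Fin.toℕ-inject₁ i)) (Fin.toℕ<n i))))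
          last : t (Fin.suc (Fin.fromℕ p′)) ≡ x ^ p
          last rewrite Fin.toℕ-fromℕ p′ | nCn≡1 p | ℕ.n∸n≡0 p′ = ≡.trans (R.+-identityʳ _) (R.*-identityʳ (x ^ p))

      frobenius-neg : ∀ x → (- x) ^ p ≡ - (x ^ p)
      frobenius-neg x = inverseˡ-unique ((- x) ^ p) (x ^ p)
        (≡.trans (≡.sym (frobenius-+ (- x) x)) (≡.trans (≡.cong (_^ p) (R.-‿inverseˡ x)) (0^ p-prime)))
        where
        open import Algebra.Properties.Group R.+-group using (inverseˡ-unique)
        0^ : ∀ {p} → Prime p → 0# ^ p ≡ 0#
        0^ {zero}  pp = contradiction pp ¬prime[0]
        0^ {suc p} pp = R.zeroˡ _

      frobenius-injective : ∀ {x y} → x ^ p ≡ y ^ p → x ≡ y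
      frobenius-injective {x} {y} eq = x-y≡0⇒x≡y x y (^-0 p (begin
        (x + (- y)) ^ p            ≡⟨ frobenius-+ x (- y) ⟩
        (x ^ p) + ((- y) ^ p)      ≡⟨ ≡.cong ((x ^ p) +_) (frobenius-neg y) ⟩
        (x ^ p) + (- (y ^ p))      ≡⟨ ≡.cong (λ s → s + (- (y ^ p))) eq ⟩
        (y ^ p) + (- (y ^ p))      ≡⟨ R.-‿inverseʳ (y ^ p) ⟩
        0#                         ∎))

    γ^≢0 : ∀ e → γ ^ e ≢ 0#
    γ^≢0 = ^-≢0 γ≢0

    γ^-cancel : ∀ a d → γ ^ a ≡ γ ^ (a ℕ.+ d) → γ ^ d ≡ 1#
    γ^-cancel a d eq = x-y≡0⇒x≡y (γ ^ d) 1# (*-cancel-0 (γ^≢0 a) (begin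
      (γ ^ a) * ((γ ^ d) + (- 1#))                   ≡⟨ R.distribˡ (γ ^ a) (γ ^ d) (- 1#) ⟩
      ((γ ^ a) * (γ ^ d)) + ((γ ^ a) * (- 1#))       ≡⟨ ≡.cong₂ _+_ (≡.trans (≡.sym (^-homo-* γ a d)) (≡.sym eq))
                                                         (≡.trans (≡.sym (-‿distribʳ-* (γ ^ a) 1#)) (≡.cong -_ (R.*-identityʳ (γ ^ a)))) ⟩
      (γ ^ a) + (- (γ ^ a))                          ≡⟨ R.-‿inverseʳ (γ ^ a) ⟩
      0#                                             ∎))

    γ^-% : ∀ d .{{_ : NonZero d}} → γ ^ d ≡ 1# → ∀ e → γ ^ (e % d) ≡ γ ^ e
    γ^-% d γ^d≡1 e = ≡.sym (begin
      γ ^ e                                    ≡⟨ ≡.cong (γ ^_) (≡.trans (m≡m%n+[m/n]*n e d) (≡.cong (e % d ℕ.+_) (ℕ.*-comm (e / d) d))) ⟩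
      γ ^ (e % d ℕ.+ d ℕ.* (e / d))            ≡⟨ ^-homo-* γ (e % d) (d ℕ.* (e / d)) ⟩
      (γ ^ (e % d)) * (γ ^ (d ℕ.* (e / d)))    ≡⟨ ≡.cong ((γ ^ (e % d)) *_) (begin
        γ ^ (d ℕ.* (e / d))                      ≡⟨ ^-assocʳ γ d (e / d) ⟨
        (γ ^ d) ^ (e / d)                        ≡⟨ ≡.cong (_^ (e / d)) γ^d≡1 ⟩
        1# ^ (e / d)                             ≡⟨ 1^ (e / d) ⟩
        1#                                       ∎) ⟩
      (γ ^ (e % d)) * 1#                       ≡⟨ R.*-identityʳ (γ ^ (e % d)) ⟩
      γ ^ (e % d)                              ∎)

    -- The exponents mod d, together with a separate index for 0, cover the whole field.
    order-bound : ∀ d .{{_ : NonZero d}} → γ ^ d ≡ 1# → q ≤ suc d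
    order-bound d γ^d≡1 = Fin.injective⇒≤ {f = index} index-injective
      where
      index : Fin q → Fin (suc d)
      index x with x Fin.≟ 0#
      ... | yes _   = Fin.zero
      ... | no  x≢0 = Fin.suc (Fin.fromℕ< (m%n<n (proj₁ (generates x x≢0)) d))
      index-injective : Injective _≡_ _≡_ index
      index-injective {x} {y} eq with x Fin.≟ 0# | y Fin.≟ 0#
      index-injective {x} {y} eq | yes x≡0 | yes y≡0 = ≡.trans x≡0 (≡.sym y≡0)
      index-injective {x} {y} () | yes x≡0 | no  y≢0
      index-injective {x} {y} () | no  x≢0 | yes y≡0
      index-injective {x} {y} eq | no  x≢0 | no  y≢0 = begin
        x              ≡⟨ proj₂ (generates x x≢0) ⟩
        γ ^ a          ≡⟨ γ^-% d γ^d≡1 a ⟨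
        γ ^ (a % d)    ≡⟨ ≡.cong (γ ^_) (Fin.fromℕ<-injective _ _ (m%n<n a d) (m%n<n b d) (Fin.suc-injective eq)) ⟩
        γ ^ (b % d)    ≡⟨ γ^-% d γ^d≡1 b ⟩
        γ ^ b          ≡⟨ proj₂ (generates y y≢0) ⟨
        y              ∎
        where
        a b : ℕ
        a = proj₁ (generates x x≢0)
        b = proj₁ (generates y y≢0)

    -- Listing 0 before γ⁰, ..., γ^(q - 1) makes q + 1 values. As 0 is no power of γ, two powers
    -- collide, and the exponents differ by at most q - 1 rather than q.
    repetition : ∃[ d ] 1 ≤ d × d ≤ q ∸ 1 × γ ^ d ≡ 1#
    repetition = let i , j , i<j , eq = Fin.pigeonhole (ℕ.n<1+n q) value in go i j i<j eq
      where
      value : Fin (suc q) → Fin q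
      value Fin.zero    = 0#
      value (Fin.suc i) = γ ^ toℕ i
      go : ∀ i j → i Fin.< j → value i ≡ value j → ∃[ d ] 1 ≤ d × d ≤ q ∸ 1 × γ ^ d ≡ 1#
      go Fin.zero    (Fin.suc j) _         eq = contradiction (≡.sym eq) (γ^≢0 (toℕ j))
      go (Fin.suc i) (Fin.suc j) (s≤s i<j) eq with d , i+d≡j ← ℕ.m≤n⇒∃[o]m+o≡n (ℕ.<⇒≤ i<j) =
        d , ℕ.+-cancelˡ-< (toℕ i) 0 d (≡.subst₂ ℕ._<_ (≡.sym (ℕ.+-identityʳ (toℕ i))) (≡.sym i+d≡j) i<j)
          , ℕ.≤-trans (≡.subst (d ≤_) i+d≡j (ℕ.m≤n+m d (toℕ i))) (<⇒≤pred (Fin.toℕ<n j))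
          , γ^-cancel (toℕ i) d (≡.trans eq (≡.cong (γ ^_) (≡.sym i+d≡j)))
        where
        <⇒≤pred : ∀ {m n} → m ℕ.< n → m ≤ n ∸ 1
        <⇒≤pred (s≤s m≤n) = m≤n

    1≤q-1 : 1 ≤ q ∸ 1
    1≤q-1 = let d , 1≤d , d≤q-1 , _ = repetition in ℕ.≤-trans 1≤d d≤q-1

    instance
      q-1≢0 : NonZero (q ∸ 1)
      q-1≢0 = ℕ.>-nonZero 1≤q-1

    order-minimal : ∀ d → 1 ≤ d → γ ^ d ≡ 1# → q ∸ 1 ≤ d
    order-minimal d 1≤d γ^d≡1 = ℕ.∸-monoˡ-≤ 1 (order-bound d {{ℕ.>-nonZero 1≤d}} γ^d≡1)

    γ^[q-1]≡1 : γ ^ (q ∸ 1) ≡ 1#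
    γ^[q-1]≡1 = let d , 1≤d , d≤q-1 , γ^d≡1 = repetition in
      ≡.subst (λ e → γ ^ e ≡ 1#) (ℕ.≤-antisym d≤q-1 (order-minimal d 1≤d γ^d≡1)) γ^d≡1

    order-∣ᵞ : ∀ d → γ ^ d ≡ 1# → (q ∸ 1) ∣ d
    order-∣ᵞ d γ^d≡1 with d % (q ∸ 1) ℕ.≟ 0
    ... | yes d%≡0 = m%n≡0⇒n∣m d (q ∸ 1) d%≡0
    ... | no  d%≢0 = contradiction
      (order-minimal (d % (q ∸ 1)) (ℕ.n≢0⇒n>0 d%≢0) (≡.trans (γ^-% (q ∸ 1) γ^[q-1]≡1 d) γ^d≡1))
      (ℕ.<⇒≱ (m%n<n d (q ∸ 1)))

    γ^-injective : ∀ {a b} → γ ^ a ≡ γ ^ b → a ≅ b [ q ∸ 1 ]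
    γ^-injective {a} {b} eq = [ wlog eq , (λ b≤a → ≅-sym (wlog (≡.sym eq) b≤a)) ]′ (ℕ.≤-total a b)
      where
      wlog : ∀ {a b} → γ ^ a ≡ γ ^ b → a ≤ b → a ≅ b [ q ∸ 1 ]
      wlog {a} {b} eq a≤b with d , ≡.refl ← ℕ.m≤n⇒∃[o]m+o≡n a≤b
        with divides m ≡.refl ← order-∣ᵞ d (γ^-cancel a d eq) = ≅-sym (+k*≅ a m (q ∸ 1))

    module Classes (N : ℕ) .{{_ : NonZero N}} (N∣q-1 : N ∣ q ∸ 1) where

      -- Unlike in `cyclotomicClass`, index and exponent are unbounded, so multiplication by γ^t and
      -- p-th powers act on the index without reduction mod N.
      InClass : ℕ → Fin q → Set
      InClass r x = ∃[ e ] x ≡ γ ^ e × e ≅ r [ N ]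

      γ^-classes : ∀ {a b} → γ ^ a ≡ γ ^ b → a ≅ b [ N ]
      γ^-classes eq = ≅-∣ N∣q-1 (γ^-injective eq)

      abstract
        inClass? : ∀ r x → Dec (InClass r x)
        inClass? r x with x Fin.≟ 0#
        ... | yes x≡0 = no λ (e , x≡γ^e , _) → γ^≢0 e (≡.trans (≡.sym x≡γ^e) x≡0)
        ... | no  x≢0 with l , x≡γ^l ← generates x x≢0 | l % N ℕ.≟ r % N
        ...   | yes same = yes (l , x≡γ^l , %≡⇒≅ same)
        ...   | no  diff = no λ (e , x≡γ^e , e≅r) →
          diff (≅⇒%≡ (≅-trans (γ^-classes (≡.trans (≡.sym x≡γ^l) x≡γ^e)) e≅r))

      inClass-resp : ∀ {r s x} → r ≅ s [ N ] → InClass r x → InClass s x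
      inClass-resp r≅s (e , x≡γ^e , e≅r) = e , x≡γ^e , ≅-trans e≅r r≅s

      inClass-unique : ∀ {r s x} → InClass r x → InClass s x → r ≅ s [ N ]
      inClass-unique (e , x≡γ^e , e≅r) (e′ , x≡γ^e′ , e′≅s) =
        ≅-trans (≅-sym e≅r) (≅-trans (γ^-classes (≡.trans (≡.sym x≡γ^e) x≡γ^e′)) e′≅s)

      inClass-shift : ∀ {r x} t → InClass r x → InClass (t ℕ.+ r) ((γ ^ t) * x)
      inClass-shift t (e , ≡.refl , e≅r) = t ℕ.+ e , ≡.sym (^-homo-* γ t e) , ≅-+-cong ≅-refl e≅r

      inClass-unshift : ∀ {r x} t → InClass (t ℕ.+ r) ((γ ^ t) * x) → InClass r x
      inClass-unshift {r} {x} t (e , γ^tx≡γ^e , e≅t+r) with x Fin.≟ 0#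
      ... | yes ≡.refl = contradiction (≡.trans (≡.sym γ^tx≡γ^e) (R.zeroʳ (γ ^ t))) (γ^≢0 e)
      ... | no  x≢0 with l , ≡.refl ← generates x x≢0 = l , ≡.refl ,
        ≅-+-cancelˡ t (≅-trans (γ^-classes (≡.trans (^-homo-* γ t l) γ^tx≡γ^e)) e≅t+r)

      inClass-^ : ∀ {r x} p → InClass r x → InClass (p ℕ.* r) (x ^ p)
      inClass-^ p (e , ≡.refl , e≅r) = e ℕ.* p , ^-assocʳ γ e p ,
        ≅-trans (≡⇒≅ (ℕ.*-comm e p)) (≅-*-cong (≅-refl {p}) e≅r)

      inClass-un^ : ∀ {r x} p → NonZero p → Coprime N p → InClass (p ℕ.* r) (x ^ p) → InClass r x
      inClass-un^ {r} {x} p@(suc _) _ cop (e , x^p≡γ^e , e≅pr) with x Fin.≟ 0#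
      ... | yes ≡.refl = contradiction (≡.trans (≡.sym x^p≡γ^e) (R.zeroˡ _)) (γ^≢0 e)
      ... | no  x≢0 with l , ≡.refl ← generates x x≢0 = l , ≡.refl ,
        ≅-*-cancelˡ p cop (≅-trans (≅-trans (≡⇒≅ (ℕ.*-comm p l))
          (γ^-classes (≡.trans (≡.sym (^-assocʳ γ l p)) x^p≡γ^e))) e≅pr)

      InSmallClass : ℕ → Fin q → Set
      InSmallClass M x = ∃[ e ] x ≡ γ ^ e × e % N ℕ.< M

      -- (−1)² = 1 puts twice the exponent of −1 in Nℤ, and N is odd.
      abstract
        -1-class : Coprime N 2 → ∃[ s ] - 1# ≡ γ ^ s × s ≅ 0 [ N ]
        -1-class N-odd = let s , -1≡γ^s = generates (- 1#) -1≢0 in s , -1≡γ^s ,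
          ≅-*-cancelˡ {a = s} {0} 2 N-odd (≅-trans (≡⇒≅ (ℕ.*-comm 2 s)) (γ^-classes {s ℕ.* 2} {0} (γ^2s≡1 s -1≡γ^s)))
          where
          open RingProperties R.ring using (-1*x≈-x; -‿involutive)
          -1≢0 : - 1# ≢ 0#
          -1≢0 -1≡0 = 1≢0 (≡.trans (≡.sym (-‿involutive 1#)) (≡.trans (≡.cong -_ -1≡0) -0#≈0#))
          γ^2s≡1 : ∀ s → - 1# ≡ γ ^ s → γ ^ (s ℕ.* 2) ≡ 1#
          γ^2s≡1 s -1≡γ^s = begin
            γ ^ (s ℕ.* 2)          ≡⟨ ^-assocʳ γ s 2 ⟨
            (γ ^ s) ^ 2            ≡⟨ ≡.cong (_^ 2) -1≡γ^s ⟨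
            (- 1#) * ((- 1#) * 1#) ≡⟨ ≡.cong ((- 1#) *_) (R.*-identityʳ (- 1#)) ⟩
            (- 1#) * (- 1#)        ≡⟨ -1*x≈-x (- 1#) ⟩
            - (- 1#)               ≡⟨ -‿involutive 1# ⟩
            1#                     ∎

      neg-inSmallClass : Coprime N 2 → ∀ {M x} → InSmallClass M x → InSmallClass M (- x)
      neg-inSmallClass N-odd {M} {x} (e , x≡γ^e , e%N<M) = s ℕ.+ e , (begin
        - x                    ≡⟨ -1*x≈-x x ⟨
        (- 1#) * x             ≡⟨ ≡.cong₂ _*_ -1≡γ^s x≡γ^e ⟩
        (γ ^ s) * (γ ^ e)      ≡⟨ ^-homo-* γ s e ⟨
        γ ^ (s ℕ.+ e)          ∎) ,
        ≡.subst (ℕ._< M) (≡.sym (≅⇒%≡ (≅-+-cong {s} {0} {N} {e} {e} s≅0 ≅-refl))) e%N<M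
        where
        open RingProperties R.ring using (-1*x≈-x)
        s : ℕ
        s = proj₁ (-1-class N-odd)
        -1≡γ^s : - 1# ≡ γ ^ s
        -1≡γ^s = proj₁ (proj₂ (-1-class N-odd))
        s≅0 : s ≅ 0 [ N ]
        s≅0 = proj₂ (proj₂ (-1-class N-odd))

  -- Sums over M consecutive indices

  module SlidingWindow {a ℓ} (L : CommutativeRing a ℓ) (η : ℕ → CommutativeRing.Carrier L) (M : ℕ) .{{M≢0 : NonZero M}}
    (η-shift : ∀ t → ¬ (M ∣ t) → CommutativeRing._≈_ L (η (t ℕ.+ M)) (η t))
    where

    open CommutativeRing L hiding (zero)
    open Sums L
    open SetoidReasoning setoid
    open import Algebra.Properties.Group +-group using (∙-cancelʳ; //-rightDividesˡ)

    window : ℕ → Carrier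
    window t = sum {M} λ i → η (t ℕ.+ toℕ i)

    -- Both sides sum η over t, ..., t + M.
    window-step : ∀ t → window (suc t) + η t ≈ window t + η (t ℕ.+ M)
    window-step t = begin
      window (suc t) + η t                                ≈⟨ +-comm (window (suc t)) (η t) ⟩
      η t + window (suc t)                                ≈⟨ +-cong (reflexive (≡.cong η (≡.sym (ℕ.+-identityʳ t))))
        (sum-cong-≋ {M} (λ i → reflexive (≡.cong η (≡.sym (ℕ.+-suc t (toℕ i)))))) ⟩
      sum {suc M} (λ i → η (t ℕ.+ toℕ i))                 ≈⟨ sum-init-last {M} (λ i → η (t ℕ.+ toℕ i)) ⟩
      sum {M} (λ i → η (t ℕ.+ toℕ (Fin.inject₁ i))) + η (t ℕ.+ toℕ (Fin.fromℕ M))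
        ≈⟨ +-cong (sum-cong-≋ {M} (λ i → reflexive (≡.cong (λ k → η (t ℕ.+ k)) (Fin.toℕ-inject₁ i))))
                  (reflexive (≡.cong (λ k → η (t ℕ.+ k)) (Fin.toℕ-fromℕ M))) ⟩
      window t + η (t ℕ.+ M)                              ∎

    -- This is η 1 + ... + η (M - 1). A window meets each nonzero residue class mod M once, with the
    -- same value of η every time; only its single multiple of M varies.
    κ : Carrier
    κ = window 0 - η 0

    -- η (t + M) = η t unless M divides t, so the window changes only when t passes a multiple of M.
    window-value : ∀ t → ∃[ b ] ∃[ c ] t ℕ.+ c ≡ M ℕ.* b × c ℕ.< M × window t ≈ κ + η (M ℕ.* b)
    window-value zero = 0 , 0 , ≡.sym (ℕ.*-zeroʳ M) , ℕ.>-nonZero⁻¹ M ,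
      trans (sym (//-rightDividesˡ (η 0) (window 0))) (+-congˡ (reflexive (≡.cong η (≡.sym (ℕ.*-zeroʳ M)))))
    window-value (suc t) with window-value t
    -- The multiple t = M b leaves the window and t + M = M (b + 1) enters, so the distance c to the
    -- next multiple is reset to M - 1.
    ... | b , zero , t≡Mb , _ , w≈ = suc b , ℕ.pred M , next , ℕ.≤-reflexive (ℕ.suc-pred M) ,
      ∙-cancelʳ (η t) _ _ (begin
        window (suc t) + η t             ≈⟨ window-step t ⟩
        window t + η (t ℕ.+ M)           ≈⟨ +-congʳ w≈ ⟩
        κ + η (M ℕ.* b) + η (t ℕ.+ M)    ≈⟨ +-assoc κ (η (M ℕ.* b)) (η (t ℕ.+ M)) ⟩
        κ + (η (M ℕ.* b) + η (t ℕ.+ M))  ≈⟨ +-congˡ (+-comm (η (M ℕ.* b)) (η (t ℕ.+ M))) ⟩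
        κ + (η (t ℕ.+ M) + η (M ℕ.* b))  ≈⟨ +-assoc κ (η (t ℕ.+ M)) (η (M ℕ.* b)) ⟨
        κ + η (t ℕ.+ M) + η (M ℕ.* b)    ≈⟨ +-cong (+-congˡ (reflexive (≡.cong η t+M≡))) (reflexive (≡.cong η (≡.sym t≡))) ⟩
        κ + η (M ℕ.* suc b) + η t        ∎)
      where
      t≡ : t ≡ M ℕ.* b
      t≡ = ≡.trans (≡.sym (ℕ.+-identityʳ t)) t≡Mb
      t+M≡ : t ℕ.+ M ≡ M ℕ.* suc b
      t+M≡ = ≡.trans (≡.cong (ℕ._+ M) t≡) (≡.trans (ℕ.+-comm (M ℕ.* b) M) (≡.sym (ℕ.*-suc M b)))
      next : suc t ℕ.+ ℕ.pred M ≡ M ℕ.* suc b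
      next = ≡.trans (≡.sym (ℕ.+-suc t (ℕ.pred M))) (≡.trans (≡.cong (t ℕ.+_) (ℕ.suc-pred M)) t+M≡)
    ... | b , suc c , t+c≡Mb , c<M , w≈ = b , c , ≡.trans (≡.sym (ℕ.+-suc t c)) t+c≡Mb , ℕ.<-trans (ℕ.n<1+n c) c<M ,
      trans (∙-cancelʳ (η t) _ _ (trans (window-step t) (+-congˡ (η-shift t M∤t)))) w≈
      where
      M∤t : ¬ (M ∣ t)
      M∤t M∣t = >⇒∤ c<M (∣m+n∣m⇒∣n (≡.subst (M ∣_) (≡.sym t+c≡Mb) (m∣m*n b)) M∣t)

    window-values : ∀ t → ∃[ b ] window t ≈ κ + η (M ℕ.* b)
    window-values t = let b , _ , _ , _ , w≈ = window-value t in b , w≈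

  -- Fourier transforms of the connection set and of eigenvectors

  module Spectrum {q : ℕ} (F : FiniteField q)
    (p f : ℕ) (p-prime : Prime p) (q≡p^f : q ≡ p ℕ.^ f)
    (r M N : ℕ) .{{M≢0 : NonZero M}} .{{N≢0 : NonZero N}}
    (M≤N : M ≤ N) (M*r≡N : M ℕ.* r ≡ N) (N∣q-1 : N ∣ q ∸ 1) (N-coprime-p : Coprime N p)
    (shift-power : ∀ t → ¬ (M ∣ t) → ∃[ e ] p ℕ.^ e ℕ.* t ≅ t ℕ.+ M [ N ])
    (reps : List ℕ) (reps-cover : ∀ b → Any (λ s → ∃[ e ] p ℕ.^ e ℕ.* s ≅ b [ r ]) reps)
    where

    open FiniteField F using (module R; 0#; γ; generates; inverse)
      renaming (_+_ to _⊕_; _*_ to _⊛_; -_ to ⊝_; _^_ to _^ᶠ_)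
    open FiniteFieldProperties F
    open Characteristic p f p-prime q≡p^f
    open Classes N N∣q-1

    private
      InD : Fin q → Set
      InD = InSmallClass M

    inD⇒inClass : ∀ x → InD x → ∃[ i ] InClass (toℕ {M} i) x
    inD⇒inClass x (e , x≡γ^e , e%N<M) = Fin.fromℕ< e%N<M , e , x≡γ^e ,
      ≅-sym (≅-trans (≡⇒≅ (Fin.toℕ-fromℕ< e%N<M)) (%-≅ e N))

    inClass⇒inD : ∀ x {i} → InClass (toℕ {M} i) x → InD x
    inClass⇒inD x {i} (e , x≡γ^e , e≅i) = e , x≡γ^e ,
      ≡.subst (ℕ._< M) (≡.sym (≡.trans (≅⇒%≡ e≅i) (m<n⇒m%n≡m (ℕ.<-≤-trans (Fin.toℕ<n i) M≤N)))) (Fin.toℕ<n i)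

    inClass-small-unique : ∀ x {i k} → InClass (toℕ {M} i) x → InClass (toℕ {M} k) x → i ≡ k
    inClass-small-unique x {i} {k} x∈i x∈k = Fin.toℕ-injective
      (≅⇒≡ (ℕ.<-≤-trans (Fin.toℕ<n i) M≤N) (ℕ.<-≤-trans (Fin.toℕ<n k) M≤N) (inClass-unique x∈i x∈k))

    module _ {c ℓ} (K : CommutativeRing c ℓ) (K-domain : IsCharacterDomain K)
      (characters : CharacterRing K _⊕_ 0# (_^ᶠ p)) (D? : ∀ x → Dec (InD x))
      where

      private
        module K = CommutativeRing K
        module KS = Sums K
        module KD = IsCharacterDomain K-domain
      open CharacterRing characters renaming (0# to 0#ᴸ; 1# to 1#ᴸ)
      open SetoidReasoning setoid

      η : ℕ → Carrier
      η s = sum λ x → ψ x when does (inClass? s x)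

      η-cong : ∀ {s t} → s ≅ t [ N ] → η s ≈ η t
      η-cong {s} {t} s≅t = sum-cong-≋ λ x → reflexive (≡.cong (ψ x when_)
        (does-⇔ (mk⇔ (inClass-resp s≅t) (inClass-resp (≅-sym s≅t))) (inClass? s x) (inClass? t x)))

      -- Substitute x ↦ x^p: it permutes the field, preserves ψ, and carries C_s into C_(p s); as p
      -- is prime to N, nothing outside C_s lands there.
      η-p : ∀ s → η (p ℕ.* s) ≈ η s
      η-p s = begin
        sum (λ x → ψ x when does (inClass? (p ℕ.* s) x))               ≈⟨ sum-reindex _ (_^ᶠ p) root root-^ (λ x → frobenius-injective (root-^ (x ^ᶠ p))) ⟩
        sum (λ x → ψ (x ^ᶠ p) when does (inClass? (p ℕ.* s) (x ^ᶠ p))) ≈⟨ sum-cong-≋ (λ x → trans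
          (reflexive (≡.cong (ψ (x ^ᶠ p) when_) (does-⇔ (mk⇔ (inClass-un^ p p≢0 N-coprime-p) (inClass-^ p))
            (inClass? (p ℕ.* s) (x ^ᶠ p)) (inClass? s x))))
          (when-cong (does (inClass? s x)) (ψ-σ x))) ⟩
        sum (λ x → ψ x when does (inClass? s x))                       ∎
        where
        p≢0 : NonZero p
        p≢0 = prime⇒nonZero p-prime
        root-exists : ∀ x → ∃[ y ] y ^ᶠ p ≡ x
        root-exists = injective⇒surjective (_^ᶠ p) frobenius-injective
        root : Fin q → Fin q
        root x = proj₁ (root-exists x)
        root-^ : ∀ x → root x ^ᶠ p ≡ x
        root-^ x = proj₂ (root-exists x)

      η-p^ : ∀ e s → η (p ℕ.^ e ℕ.* s) ≈ η s
      η-p^ zero    s = reflexive (≡.cong η (ℕ.*-identityˡ s))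
      η-p^ (suc e) s = trans (reflexive (≡.cong η (ℕ.*-assoc p (p ℕ.^ e) s))) (trans (η-p (p ℕ.^ e ℕ.* s)) (η-p^ e s))

      η-shift : ∀ t → ¬ (M ∣ t) → η (t ℕ.+ M) ≈ η t
      η-shift t M∤t = trans (η-cong (≅-sym (proj₂ (shift-power t M∤t)))) (η-p^ (proj₁ (shift-power t M∤t)) t)

      open SlidingWindow L η M η-shift

      -- Candidates in L, possibly with repetitions; they need not come from K.
      eigenvalues : List Carrier
      eigenvalues = List.map (λ b → κ + η (M ℕ.* b)) reps

      eigenvalues-cover : ∀ t → Any (window t ≈_) eigenvalues
      eigenvalues-cover t =
        Any.map⁺ (Any.map (λ { {s} (e , p^e*s≅b) → trans (proj₂ (window-values t)) (+-congˡ (η-M* e s p^e*s≅b)) }) (reps-cover (proj₁ (window-values t))))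
        where
        η-M* : ∀ {b} e s → p ℕ.^ e ℕ.* s ≅ b [ r ] → η (M ℕ.* b) ≈ η (M ℕ.* s)
        η-M* {b} e s p^e*s≅b = begin
          η (M ℕ.* b)                    ≈⟨ η-cong (≡.subst (M ℕ.* (p ℕ.^ e ℕ.* s) ≅ M ℕ.* b [_]) M*r≡N (≅-*-monoˡ M p^e*s≅b)) ⟨
          η (M ℕ.* (p ℕ.^ e ℕ.* s))      ≈⟨ reflexive (≡.cong η (swap M (p ℕ.^ e) s)) ⟩
          η (p ℕ.^ e ℕ.* (M ℕ.* s))      ≈⟨ η-p^ e (M ℕ.* s) ⟩
          η (M ℕ.* s)                    ∎
          where
          swap : ∀ a b c → a ℕ.* (b ℕ.* c) ≡ b ℕ.* (a ℕ.* c)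
          swap a b c = ≡.trans (≡.sym (ℕ.*-assoc a b c)) (≡.trans (≡.cong (ℕ._* c) (ℕ.*-comm a b)) (ℕ.*-assoc b a c))

      D-split : ∀ x y → y when does (D? x) ≈ sum {M} λ i → y when does (inClass? (toℕ i) x)
      D-split x = when-partition {M} {P = InD x} {Q = λ i → InClass (toℕ i) x} (D? x) (λ i → inClass? (toℕ i) x) (inD⇒inClass x) (inClass⇒inD x) (inClass-small-unique x)

      *-reindex : ∀ (g : Fin q → Carrier) {x} → x ≢ 0# → sum g ≈ sum (λ y → g (x ⊛ y))
      *-reindex g {x} x≢0 with x⁻¹ , x⁻¹x≡1 ← inverse x x≢0 = sum-reindex g (x ⊛_) (x⁻¹ ⊛_)
        (λ y → ≡.trans (≡.sym (R.*-assoc x x⁻¹ y)) (≡.trans (≡.cong (_⊛ y) (≡.trans (R.*-comm x x⁻¹) x⁻¹x≡1)) (R.*-identityˡ y)))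
        (λ y → ≡.trans (≡.sym (R.*-assoc x⁻¹ x y)) (≡.trans (≡.cong (_⊛ y) x⁻¹x≡1) (R.*-identityˡ y)))

      D̂ : Fin q → Carrier
      D̂ a = sum λ x → ψ (a ⊛ x) when does (D? x)

      -- Multiplication by γ^t carries the classes C_0, ..., C_(M - 1) to C_t, ..., C_(t + M - 1),
      -- whose periods add up to the window.
      D̂-γ^ : ∀ t → D̂ (γ ^ᶠ t) ≈ window t
      D̂-γ^ t = begin
        sum (λ x → ψ (a ⊛ x) when does (D? x))                                    ≈⟨ sum-cong-≋ (λ x → D-split x (ψ (a ⊛ x))) ⟩
        sum (λ x → sum {M} (λ i → ψ (a ⊛ x) when does (inClass? (toℕ i) x)))      ≈⟨ ∑-comm {n = M} (λ x i → ψ (a ⊛ x) when does (inClass? (toℕ i) x)) ⟩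
        sum {M} (λ i → sum (λ x → ψ (a ⊛ x) when does (inClass? (toℕ i) x)))      ≈⟨ sum-cong-≋ {M} (λ i → sum-cong-≋ (λ x → reflexive (≡.cong (ψ (a ⊛ x) when_)
          (does-⇔ (mk⇔ (inClass-shift t) (inClass-unshift t)) (inClass? (toℕ i) x) (inClass? (t ℕ.+ toℕ i) (a ⊛ x)))))) ⟩
        sum {M} (λ i → sum (λ x → ψ (a ⊛ x) when does (inClass? (t ℕ.+ toℕ i) (a ⊛ x))))
          ≈⟨ sum-cong-≋ {M} (λ i → *-reindex (λ x → ψ x when does (inClass? (t ℕ.+ toℕ i) x)) (γ^≢0 t)) ⟨
        window t                                                                  ∎
        where
        a : Fin q
        a = γ ^ᶠ t

      ι-sum : ∀ {n} (g : Fin n → K.Carrier) → ι (KS.sum g) ≈ sum (λ i → ι (g i))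
      ι-sum {zero}  g = ι-0
      ι-sum {suc n} g = trans (ι-+ (g Fin.zero) (KS.sum (g ∘ Fin.suc))) (+-congˡ (ι-sum (g ∘ Fin.suc)))

      orthogonality : ∀ b → b ≢ 0# → sum (λ a → ψ (a ⊛ b)) ≈ 0#ᴸ
      orthogonality b b≢0 = trans (sum-cong-≋ (λ a → reflexive (≡.cong ψ (R.*-comm a b)))) (trans (sym (*-reindex ψ b≢0)) ∑ψ≈0)

      module _ (v : Fin q → K.Carrier) where

        v̂ : Fin q → Carrier
        v̂ a = sum λ x → ι (v x) * ψ (a ⊛ x)

        v̂-0 : KS.sum v K.≈ K.0# → v̂ 0# ≈ 0#ᴸ
        v̂-0 ∑v≈0 = begin
          sum (λ x → ι (v x) * ψ (0# ⊛ x))   ≈⟨ sum-cong-≋ (λ x → trans (*-congˡ (trans (reflexive (≡.cong ψ (R.zeroˡ x))) ψ-0)) (*-identityʳ (ι (v x)))) ⟩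
          sum (λ x → ι (v x))                ≈⟨ ι-sum v ⟨
          ι (KS.sum v)                       ≈⟨ ι-cong ∑v≈0 ⟩
          ι K.0#                             ≈⟨ ι-0 ⟩
          0#ᴸ                                ∎

        -- Fourier inversion by orthogonality of characters. The factor q stays on the right, as a
        -- sum of q ones, so that no division is required.
        inversion : ∀ x → sum (λ a → ψ (a ⊛ (⊝ x)) * v̂ a) ≈ ι (v x) * ι (KS.sum {q} (λ _ → K.1#))
        inversion x = begin
          sum (λ a → ψ (a ⊛ (⊝ x)) * v̂ a)
            ≈⟨ sum-cong-≋ (λ a → trans (*-distribˡ-sum (ψ (a ⊛ (⊝ x))) (λ y → ι (v y) * ψ (a ⊛ y))) (sum-cong-≋ (λ y → combine a y))) ⟩
          sum (λ a → sum (λ y → ι (v y) * ψ (a ⊛ (y ⊕ (⊝ x)))))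
            ≈⟨ ∑-comm (λ a y → ι (v y) * ψ (a ⊛ (y ⊕ (⊝ x)))) ⟩
          sum (λ y → sum (λ a → ι (v y) * ψ (a ⊛ (y ⊕ (⊝ x)))))
            ≈⟨ sum-cong-≋ (λ y → sym (*-distribˡ-sum (ι (v y)) (λ a → ψ (a ⊛ (y ⊕ (⊝ x)))))) ⟩
          sum (λ y → ι (v y) * sum (λ a → ψ (a ⊛ (y ⊕ (⊝ x)))))
            ≈⟨ sum-single x (λ y y≢x → trans (*-congˡ (orthogonality (y ⊕ (⊝ x)) (λ eq → y≢x (x-y≡0⇒x≡y y x eq)))) (zeroʳ (ι (v y)))) ⟩
          ι (v x) * sum (λ a → ψ (a ⊛ (x ⊕ (⊝ x))))
            ≈⟨ *-congˡ (sum-cong-≋ (λ a → trans (reflexive (≡.cong ψ (≡.trans (≡.cong (a ⊛_) (R.-‿inverseʳ x)) (R.zeroʳ a)))) (trans ψ-0 (sym ι-1)))) ⟩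
          ι (v x) * sum {q} (λ _ → ι K.1#)
            ≈⟨ *-congˡ (sym (ι-sum {q} (λ _ → K.1#))) ⟩
          ι (v x) * ι (KS.sum {q} (λ _ → K.1#))      ∎
          where
          combine : ∀ a y → ψ (a ⊛ (⊝ x)) * (ι (v y) * ψ (a ⊛ y)) ≈ ι (v y) * ψ (a ⊛ (y ⊕ (⊝ x)))
          combine a y = begin
            ψ (a ⊛ (⊝ x)) * (ι (v y) * ψ (a ⊛ y))   ≈⟨ *-comm _ _ ⟩
            ι (v y) * ψ (a ⊛ y) * ψ (a ⊛ (⊝ x))     ≈⟨ *-assoc _ _ _ ⟩
            ι (v y) * (ψ (a ⊛ y) * ψ (a ⊛ (⊝ x)))   ≈⟨ *-congˡ (ψ-⊕ (a ⊛ y) (a ⊛ (⊝ x))) ⟨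
            ι (v y) * ψ ((a ⊛ y) ⊕ (a ⊛ (⊝ x)))     ≈⟨ *-congˡ (reflexive (≡.cong ψ (≡.sym (R.distribˡ a y (⊝ x))))) ⟩
            ι (v y) * ψ (a ⊛ (y ⊕ (⊝ x)))           ∎

        module _ (θ : K.Carrier)
          (eigen : ∀ x → KS.sum (λ y → (K.1# KS.when does (D? (x ⊕ (⊝ y)))) K.* v y) K.≈ θ K.* v x)
          where

          ι-eigen : ∀ x → ι θ * ι (v x) ≈ sum (λ y → ι (v y) when does (D? (x ⊕ (⊝ y))))
          ι-eigen x = begin
            ι θ * ι (v x)                                                              ≈⟨ ι-* θ (v x) ⟨
            ι (θ K.* v x)                                                              ≈⟨ ι-cong (eigen x) ⟨
            ι (KS.sum (λ y → (K.1# KS.when does (D? (x ⊕ (⊝ y)))) K.* v y))            ≈⟨ ι-sum (λ y → (K.1# KS.when does (D? (x ⊕ (⊝ y)))) K.* v y) ⟩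
            sum (λ y → ι ((K.1# KS.when does (D? (x ⊕ (⊝ y)))) K.* v y))               ≈⟨ sum-cong-≋ (λ y → ι-when (does (D? (x ⊕ (⊝ y)))) (v y)) ⟩
            sum (λ y → ι (v y) when does (D? (x ⊕ (⊝ y))))                             ∎
            where
            ι-when : ∀ b k → ι ((K.1# KS.when b) K.* k) ≈ ι k when b
            ι-when true  k = ι-cong (K.*-identityˡ k)
            ι-when false k = trans (ι-cong (K.zeroˡ k)) ι-0

          -- The adjacency operator is convolution with the indicator of D, which the transform
          -- turns into multiplication by D̂.
          eigen-v̂ : ∀ a → ι θ * v̂ a ≈ D̂ a * v̂ a
          eigen-v̂ a = begin
            ι θ * sum (λ x → ι (v x) * ψ (a ⊛ x))                                     ≈⟨ *-distribˡ-sum (ι θ) (λ x → ι (v x) * ψ (a ⊛ x)) ⟩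
            sum (λ x → ι θ * (ι (v x) * ψ (a ⊛ x)))                                   ≈⟨ sum-cong-≋ (λ x → trans (sym (*-assoc (ι θ) (ι (v x)) (ψ (a ⊛ x)))) (trans (*-congʳ (ι-eigen x))
              (*-distribʳ-sum (ψ (a ⊛ x)) (λ y → ι (v y) when does (D? (x ⊕ (⊝ y))))))) ⟩
            sum (λ x → sum (λ y → (ι (v y) when does (D? (x ⊕ (⊝ y)))) * ψ (a ⊛ x)))  ≈⟨ ∑-comm (λ x y → (ι (v y) when does (D? (x ⊕ (⊝ y)))) * ψ (a ⊛ x)) ⟩
            sum (λ y → sum (λ x → (ι (v y) when does (D? (x ⊕ (⊝ y)))) * ψ (a ⊛ x)))  ≈⟨ sum-cong-≋ inner ⟩
            sum (λ y → D̂ a * (ι (v y) * ψ (a ⊛ y)))                                  ≈⟨ *-distribˡ-sum (D̂ a) (λ y → ι (v y) * ψ (a ⊛ y)) ⟨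
            D̂ a * v̂ a                                                               ∎
            where
            open import Algebra.Properties.Group R.+-group using () renaming (//-rightDividesˡ to ⊖-⊕; //-rightDividesʳ to ⊕-⊖)
            term : ∀ y x → (ι (v y) when does (D? ((x ⊕ y) ⊕ (⊝ y)))) * ψ (a ⊛ (x ⊕ y)) ≈ ψ (a ⊛ x) when does (D? x) * (ι (v y) * ψ (a ⊛ y))
            term y x rewrite ⊕-⊖ y x | R.distribˡ a x y with does (D? x)
            ... | false = trans (zeroˡ _) (sym (zeroˡ _))
            ... | true  = begin
              ι (v y) * ψ ((a ⊛ x) ⊕ (a ⊛ y))      ≈⟨ *-congˡ (ψ-⊕ (a ⊛ x) (a ⊛ y)) ⟩
              ι (v y) * (ψ (a ⊛ x) * ψ (a ⊛ y))    ≈⟨ *-assoc _ _ _ ⟨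
              ι (v y) * ψ (a ⊛ x) * ψ (a ⊛ y)      ≈⟨ *-congʳ (*-comm _ _) ⟩
              ψ (a ⊛ x) * ι (v y) * ψ (a ⊛ y)      ≈⟨ *-assoc _ _ _ ⟩
              ψ (a ⊛ x) * (ι (v y) * ψ (a ⊛ y))    ∎
            inner : ∀ y → sum (λ x → (ι (v y) when does (D? (x ⊕ (⊝ y)))) * ψ (a ⊛ x)) ≈ D̂ a * (ι (v y) * ψ (a ⊛ y))
            inner y = begin
              sum (λ x → (ι (v y) when does (D? (x ⊕ (⊝ y)))) * ψ (a ⊛ x))
                ≈⟨ sum-reindex _ (_⊕ y) (_⊕ (⊝ y)) (⊖-⊕ y) (⊕-⊖ y) ⟩
              sum (λ x → (ι (v y) when does (D? ((x ⊕ y) ⊕ (⊝ y)))) * ψ (a ⊛ (x ⊕ y)))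
                ≈⟨ sum-cong-≋ (term y) ⟩
              sum (λ x → ψ (a ⊛ x) when does (D? x) * (ι (v y) * ψ (a ⊛ y)))
                ≈⟨ *-distribʳ-sum (ι (v y) * ψ (a ⊛ y)) (λ x → ψ (a ⊛ x) when does (D? x)) ⟨
              D̂ a * (ι (v y) * ψ (a ⊛ y))            ∎

          open MonicFunctions L using (linearFactors; linearFactors-annihilates)

          π : Carrier
          π = linearFactors eigenvalues (ι θ)

          -- Orthogonality to the all-one vector settles a = 0, where D̂ takes the value |D|; any
          -- other a is a power of γ, and there one factor of π annihilates v̂ a.
          π-v̂ : KS.sum v K.≈ K.0# → ∀ a → π * v̂ a ≈ 0#ᴸ
          π-v̂ ∑v≈0 a with a Fin.≟ 0#
          ... | yes ≡.refl = trans (*-congˡ (v̂-0 ∑v≈0)) (zeroʳ π)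
          ... | no  a≢0 with t , ≡.refl ← generates a a≢0 = linearFactors-annihilates (ι θ) (v̂ a)
            (Any.map (λ {l} w≈l → begin
              (ι θ - l) * v̂ a            ≈⟨ distribʳ (v̂ a) (ι θ) (- l) ⟩
              ι θ * v̂ a + - l * v̂ a      ≈⟨ +-cong (trans (eigen-v̂ a) (*-congʳ (trans (D̂-γ^ t) w≈l))) (sym (-‿distribˡ-* l (v̂ a))) ⟩
              l * v̂ a - l * v̂ a          ≈⟨ -‿inverseʳ (l * v̂ a) ⟩
              0#ᴸ                        ∎) (eigenvalues-cover t))
            where open RingProperties ring using (-‿distribˡ-*)

          -- By inversion π annihilates q v(x) for all x. No x with v(x) ≠ 0 can be exhibited, so
          -- one assumes π ≠ 0: then no v(x) is nonzero, and stability of equality makes v vanish.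
          π≈0 : KS.sum v K.≈ K.0# → ¬ (∀ x → v x K.≈ K.0#) → π ≈ 0#ᴸ
          π≈0 ∑v≈0 v≉0 = stable λ π≉0 → v≉0 λ x → KD.stable λ vx≉0 → π≉0 (ι-cancel q≉0 (ι-cancel vx≉0 (begin
            ι (v x) * (ι Q * π)                          ≈⟨ *-assoc _ _ _ ⟨
            ι (v x) * ι Q * π                            ≈⟨ *-comm _ _ ⟩
            π * (ι (v x) * ι Q)                          ≈⟨ *-congˡ (inversion x) ⟨
            π * sum (λ a → ψ (a ⊛ (⊝ x)) * v̂ a)          ≈⟨ *-distribˡ-sum π (λ a → ψ (a ⊛ (⊝ x)) * v̂ a) ⟩
            sum (λ a → π * (ψ (a ⊛ (⊝ x)) * v̂ a))        ≈⟨ sum-zero (λ a → trans (sym (*-assoc _ _ _)) (trans (*-congʳ (*-comm _ _))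
                                                            (trans (*-assoc _ _ _) (trans (*-congˡ (π-v̂ ∑v≈0 a)) (zeroʳ _))))) ⟩
            0#ᴸ                                          ∎)))
            where
            Q : K.Carrier
            Q = KS.sum {q} (λ _ → K.1#)
            q≉0 : ¬ (Q K.≈ K.0#)
            q≉0 Q≈0 = positive q (Fin.nonZeroIndex γ) (K.trans (K.sym (KS.sum-replicate q)) Q≈0)
              where
              open Mult K.semiring using () renaming (_×_ to _·_)
              positive : ∀ n → NonZero n → ¬ (n · K.1# K.≈ K.0#)
              positive (suc n) _ = KD.charZero n

      eigenvalue-bound : ∀ n (θ : Fin n → K.Carrier) → Injective _≡_ K._≈_ θ → (v : Fin n → Fin q → K.Carrier) →
        (∀ i x → KS.sum (λ y → (K.1# KS.when does (D? (x ⊕ (⊝ y)))) K.* v i y) K.≈ θ i K.* v i x) →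
        (∀ i → KS.sum (v i) K.≈ K.0#) → (∀ i → ¬ (∀ x → v i x K.≈ K.0#)) → n ≤ List.length reps
      eigenvalue-bound n θ θ-inj v eigen ∑v≈0 v≉0 = ≡.subst (n ≤_) (length-map _ reps)
        (roots≤degree (linearFactors-monic eigenvalues) 1≉0 (ι ∘ θ)
          (λ i → π≈0 (v i) (θ i) (eigen i) (∑v≈0 i) (v≉0 i))
          -- Distinct θ differ by a nonzero element of K, whose image in L can be cancelled.
          (λ i k i≢k y eq → ι-cancel {θ i K.- θ k} (λ θi-θk≈0 → i≢k (θ-inj (K-x∙y⁻¹≈ε⇒x≈y _ _ θi-θk≈0)))
            (trans (*-congʳ (trans (ι-+ (θ i) (K.- θ k)) (+-congˡ (ι-neg (θ k))))) eq)))
        where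
        open MonicFunctions L using (roots≤degree; linearFactors-monic)
        open import Algebra.Properties.Group K.+-group using () renaming (x∙y⁻¹≈ε⇒x≈y to K-x∙y⁻¹≈ε⇒x≈y)

  -- Passage from Heyting fields to `Fin q`

  -- Tightness gives equality once apartness is refuted, so each equation is proved by assuming its
  -- two sides apart.
  heytingField⇒characterDomain : ∀ {c ℓ₁ ℓ₂} (K : HeytingField c ℓ₁ ℓ₂) → CharacteristicZero K →
    IsCharacterDomain (record { isCommutativeRing = HeytingField.isCommutativeRing K })
  heytingField⇒characterDomain K charZero = record
    { stable   = λ ¬¬x≈y → proj₁ (tight _ _) λ x#y → ¬¬x≈y λ x≈y → #-irrefl x≈y x#y
    ; cancel   = λ x≉0 xy≈0 → proj₁ (tight _ _) λ y#0 → x≉0 (proj₁ (tight _ _) λ x#0 →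
                   #-irrefl xy≈0 (x#0y#0→xy#0 x#0 y#0))
    ; charZero = charZero
    }
    where
    open HeytingField K
    open HeytingProperties heytingCommutativeRing using (x#0y#0→xy#0)

  -- The field structure is carried over to Fin q, where equality is propositional and
  -- functions need no congruence proofs.
  module OnFin {c ℓ₁ ℓ₂} (F : HeytingField c ℓ₁ ℓ₂) {q : ℕ} (enum : Enumeration q (HeytingField.setoid F))
    (γ : HeytingField.Carrier F) (γ-primitive : IsPrimitive F γ)
    where

    open HeytingField F
    open HeytingProperties heytingCommutativeRing using (1#0; invertibleˡ⇒#; x-0≈x)
    open Inverse enum using (to; from; to-cong; from-cong; strictlyInverseˡ; strictlyInverseʳ)
    open IsPrimitive γ-primitive

    commutativeRing : CommutativeRing c ℓ₁
    commutativeRing = record { isCommutativeRing = isCommutativeRing }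

    open Exp (CommutativeRing.semiring commutativeRing) using (_^_)

    rawRing : RawRing _ _
    rawRing = record
      { Carrier = Fin q ; _≈_ = _≡_
      ; _+_ = λ i k → from (to i + to k) ; _*_ = λ i k → from (to i * to k) ; -_ = λ i → from (- to i)
      ; 0# = from 0# ; 1# = from 1#
      }

    to-injective : Injective _≡_ _≈_ to
    to-injective eq = ≡.trans (≡.sym (strictlyInverseʳ _)) (≡.trans (from-cong eq) (strictlyInverseʳ _))

    to-isRingMonomorphism : IsRingMonomorphism rawRing (CommutativeRing.rawRing commutativeRing) to
    to-isRingMonomorphism = record
      { isRingHomomorphism = record
        { isSemiringHomomorphism = record
          { isNearSemiringHomomorphism = record
            { +-isMonoidHomomorphism = record
              { isMagmaHomomorphism = record
                { isRelHomomorphism = record { cong = to-cong }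
                ; homo              = λ i k → strictlyInverseˡ (to i + to k)
                }
              ; ε-homo = strictlyInverseˡ 0#
              }
            ; *-homo = λ i k → strictlyInverseˡ (to i * to k)
            }
          ; 1#-homo = strictlyInverseˡ 1#
          }
        ; -‿homo = λ i → strictlyInverseˡ (- to i)
        }
      ; injective = to-injective
      }

    1≢0 : from 1# ≢ from 0#
    1≢0 eq = #-irrefl (trans (sym (strictlyInverseˡ 1#)) (trans (to-cong eq) (strictlyInverseˡ 0#))) 1#0

    -- Invertibility is decidable in a finite ring, so tightness of # yields actual inverses.
    inverse : ∀ x → x ≢ from 0# → ∃[ y ] from (to y * to x) ≡ from 1#
    inverse x x≢0 with Fin.any? (λ y → from (to y * to x) Fin.≟ from 1#)
    ... | yes invertible = invertible
    ... | no ¬invertible = contradiction (≡.trans (≡.sym (strictlyInverseʳ x)) (from-cong x≈0)) x≢0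
      where
      x≈0 : to x ≈ 0#
      x≈0 = proj₁ (tight _ _) λ x#0 → let y , y*[x-0]≈1 , _ = #⇒invertible x#0 in
        ¬invertible (from y , from-cong (trans (*-cong (strictlyInverseˡ y) (sym (x-0≈x (to x)))) y*[x-0]≈1))

    -- Inequality does not yield apartness in a general Heyting field; here `inverse` supplies an
    -- inverse, and invertible elements are apart from 0.
    nonzero⇒#0 : ∀ x → x ≢ from 0# → to x # 0#
    nonzero⇒#0 x x≢0 = let y , yx≡1 = inverse x x≢0 in invertibleˡ⇒# (to y , trans (*-congˡ (x-0≈x (to x)))
      (trans (sym (strictlyInverseˡ _)) (trans (to-cong yx≡1) (strictlyInverseˡ 1#))))

    isCommutativeRingᶠ : IsCommutativeRing _≡_ _ _ _ _ _
    isCommutativeRingᶠ = RingMonomorphism.isCommutativeRing to-isRingMonomorphism isCommutativeRing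

    commutativeRingᶠ : CommutativeRing _ _
    commutativeRingᶠ = record { isCommutativeRing = isCommutativeRingᶠ }

    private
      module ^ᶠ = Exp (CommutativeRing.semiring commutativeRingᶠ)

    to-^ : ∀ e → to (from γ ^ᶠ.^ e) ≈ γ ^ e
    to-^ zero    = strictlyInverseˡ 1#
    to-^ (suc e) = trans (strictlyInverseˡ _) (*-cong (strictlyInverseˡ γ) (to-^ e))

    from-^ : ∀ {x} e → x ≈ γ ^ e → from x ≡ from γ ^ᶠ.^ e
    from-^ {x} e x≈γ^e = to-injective (trans (strictlyInverseˡ x) (trans x≈γ^e (sym (to-^ e))))

    finiteField : FiniteField q
    finiteField = record
      { isCommutativeRing = isCommutativeRingᶠ
      ; 1≢0       = 1≢0
      ; inverse   = inverse
      ; γ         = from γ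
      ; γ≢0       = λ eq → #-irrefl (trans (sym (strictlyInverseˡ γ)) (trans (to-cong eq) (strictlyInverseˡ 0#))) unit
      ; generates = λ x x≢0 → let e , x≈γ^e = generates (to x) (nonzero⇒#0 x x≢0) in
          e , ≡.trans (≡.sym (strictlyInverseʳ x)) (from-^ e x≈γ^e)
      }

    open FiniteFieldProperties finiteField

    module _ (N M : ℕ) .{{_ : NonZero N}} (N∣q-1 : N ∣ q ∸ 1) (M≤N : M ≤ N) where
      open Classes N N∣q-1

      D : ConnectionSet F ℓ₁
      D = cyclotomicUnion F enum γ γ-primitive N M
      open ConnectionSet D

      member⇒small : ∀ {x} → Member x → InSmallClass M (from x)
      member⇒small (i , k , x≈) = toℕ i ℕ.+ toℕ k ℕ.* N , from-^ (toℕ i ℕ.+ toℕ k ℕ.* N) x≈ ,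
        ≡.subst (ℕ._< M) (≡.sym (≡.trans ([m+kn]%n≡m%n (toℕ i) (toℕ k) N) (m<n⇒m%n≡m (ℕ.<-≤-trans (Fin.toℕ<n i) M≤N)))) (Fin.toℕ<n i)

      -- The exponent is first reduced mod q - 1, which brings its quotient by N below (q - 1) / N;
      -- its residue mod N survives because N divides q - 1.
      small⇒member : ∀ {x} → InSmallClass M (from x) → Member x
      small⇒member {x} (e , x≡γ^e , e%N<M) = Fin.fromℕ< e′%N<M , Fin.fromℕ< e′/N< , (begin
        x                                 ≈⟨ strictlyInverseˡ x ⟨
        to (from x)                       ≈⟨ to-cong (≡.trans x≡γ^e (≡.sym (γ^-% (q ∸ 1) γ^[q-1]≡1 e))) ⟩
        to (from γ ^ᶠ.^ e′)               ≈⟨ to-^ e′ ⟩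
        γ ^ e′                            ≡⟨ ≡.cong (γ ^_) (≡.trans (m≡m%n+[m/n]*n e′ N)
          (≡.sym (≡.cong₂ (λ a b → a ℕ.+ b ℕ.* N) (Fin.toℕ-fromℕ< e′%N<M) (Fin.toℕ-fromℕ< e′/N<)))) ⟩
        γ ^ (toℕ (Fin.fromℕ< e′%N<M) ℕ.+ toℕ (Fin.fromℕ< e′/N<) ℕ.* N)  ∎)
        where
        open SetoidReasoning setoid
        e′ : ℕ
        e′ = e % (q ∸ 1)
        e′%N<M : e′ % N ℕ.< M
        e′%N<M = ≡.subst (ℕ._< M) (≡.sym (m∣n⇒o%n%m≡o%m N (q ∸ 1) e N∣q-1)) e%N<M
        e′/N< : e′ / N ℕ.< (q ∸ 1) / N
        e′/N< = m<n*o⇒m/o<n (≡.subst (e′ ℕ.<_) (≡.sym (m/n*n≡m N∣q-1)) (m%n<n e (q ∸ 1)))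

      -- Obtained from `member?` so that both have the same Boolean by definition, on which
      -- `adjacent-does` relies.
      D? : ∀ x → Dec (InSmallClass M x)
      D? x = map′ (λ m → ≡.subst (InSmallClass M) (strictlyInverseʳ x) (member⇒small m))
        (λ s → small⇒member (≡.subst (InSmallClass M) (≡.sym (strictlyInverseʳ x)) s)) (member? (to x))

      open FiniteField finiteField using () renaming (_+_ to _+ᶠ_; -_ to -ᶠ_)

      adjacent-does : ∀ x y → does (member? (to x - to y)) ≡ does (D? (x +ᶠ (-ᶠ y)))
      adjacent-does x y = does-⇔ (mk⇔ (member-resp eq) (member-resp (sym eq)))
        (member? (to x - to y)) (member? (to (x +ᶠ (-ᶠ y))))
        where
        eq : to x - to y ≈ to (x +ᶠ (-ᶠ y))
        eq = sym (trans (strictlyInverseˡ (to x + to (-ᶠ y))) (+-congˡ (strictlyInverseˡ (- to y))))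

      undirected : Coprime N 2 → Undirected (Cay F enum D)
      undirected N-odd {x} {y} x-y∈D = member-resp -[x-y]≈y-x
        (small⇒member (≡.subst (InSmallClass M) (from-cong (-‿cong (strictlyInverseˡ (x - y)))) (neg-inSmallClass N-odd (member⇒small x-y∈D))))
        where
        open import Algebra.Properties.AbelianGroup (CommutativeRing.+-abelianGroup commutativeRing) using (⁻¹-anti-homo‿-)
        -[x-y]≈y-x : - (x - y) ≈ y - x
        -[x-y]≈y-x = ⁻¹-anti-homo‿- x y

      module _ (p f : ℕ) (p-prime : Prime p) (q≡p^f : q ≡ p ℕ.^ f) .{{_ : NonZero M}}
        (r : ℕ) (M*r≡N : M ℕ.* r ≡ N) (N-coprime-p : Coprime N p)
        (shift-power : ∀ t → ¬ (M ∣ t) → ∃[ e ] p ℕ.^ e ℕ.* t ≅ t ℕ.+ M [ N ])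
        (reps : List ℕ) (reps-cover : ∀ b → Any (λ s → ∃[ e ] p ℕ.^ e ℕ.* s ≅ b [ r ]) reps)
        where

        open Spectrum finiteField p f p-prime q≡p^f r M N M≤N M*r≡N N∣q-1 N-coprime-p shift-power reps reps-cover
        open FiniteField finiteField using () renaming (0# to 0ᶠ; 1# to 1ᶠ; _^_ to _^ᶠ_)

        restrictedEigenvalues : ∀ {k ℓ₃ ℓ₄} (K : HeytingField k ℓ₃ ℓ₄) → CharacteristicZero K →
          AtMost K (List.length reps) (RestrictedEigenvalue K (Cay F enum D))
        restrictedEigenvalues K K-char0 n θ θ-injective restricted =
          eigenvalue-bound KR K-domain characters D? n θ θ-injective (λ i → proj₁ (restricted i)) eigen
            (λ i → K.trans (sum-cong-≋ (λ x → K.sym (K.*-identityˡ (proj₁ (restricted i) x)))) (proj₂ (proj₂ (restricted i))))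
            (λ i → IsEigenvector.nonzero (proj₁ (proj₂ (restricted i))))
          where
          KR : CommutativeRing _ _
          KR = record { isCommutativeRing = HeytingField.isCommutativeRing K }
          module K = CommutativeRing KR
          open Sums KR using (sum; sum-cong-≋; _when_)
          K-domain : IsCharacterDomain KR
          K-domain = heytingField⇒characterDomain K K-char0
          characters : CharacterRing KR _+ᶠ_ 0ᶠ (_^ᶠ p)
          -- σ is the Frobenius map, and its nonzero fixed point is 1.
          characters = Construction.characterRing KR K-domain _+ᶠ_ 0ᶠ -ᶠ_
            (IsCommutativeRing.+-isAbelianGroup isCommutativeRingᶠ) (_^ᶠ p)
            (Characteristic.frobenius-+ p f p-prime q≡p^f) 1ᶠ 1≢0 (1^ p)
          eigen : ∀ i x → sum (λ y → (K.1# when does (D? (x +ᶠ (-ᶠ y)))) K.* proj₁ (restricted i) y) K.≈ θ i K.* proj₁ (restricted i) x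
          eigen i x = K.trans
            (sum-cong-≋ (λ y → K.reflexive (≡.cong (λ b → (K.1# when b) K.* proj₁ (restricted i) y) (≡.sym (adjacent-does x y)))))
            (IsEigenvector.eigen (proj₁ (proj₂ (restricted i))) x)

    module NatSum = MonoidSum ℕ.+-0-commutativeMonoid

    count-tabulate : ∀ {a p n} {A : Set a} {P : A → Set p} (P? : ∀ x → Dec (P x)) (g : Fin n → A) →
      Vec.count P? (Vec.tabulate g) ≡ NatSum.sum (λ i → if does (P? (g i)) then 1 else 0)
    count-tabulate {n = zero}  P? g = ≡.refl
    count-tabulate {n = suc n} P? g with does (P? (g Fin.zero)) | count-tabulate P? (g ∘ Fin.suc)
    ... | true  | eq = ≡.cong suc eq
    ... | false | eq = eq

    -- The involution y ↦ x - y exchanges the neighbourhood of x with D.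
    regular : ∀ {ℓ} (D : ConnectionSet F ℓ) → Regular (Cay F enum D) (cardinality enum (ConnectionSet.member? D))
    regular D x = begin
      Vec.count (λ y → member? (x - y)) (Vec.tabulate to)
        ≡⟨ count-tabulate (λ y → member? (x - y)) to ⟩
      NatSum.sum (λ i → if does (member? (x - to i)) then 1 else 0)
        ≡⟨ NatSum.sum-cong-≗ (λ i → ≡.cong (λ b → if b then 1 else 0) (does-⇔
          (mk⇔ (member-resp (sym (strictlyInverseˡ _))) (member-resp (strictlyInverseˡ _))) (member? (x - to i)) (member? (to (reflect i))))) ⟩
      NatSum.sum (λ i → if does (member? (to (reflect i))) then 1 else 0)
        ≡⟨ NatSum.sum-permute (λ i → if does (member? (to i)) then 1 else 0) (Permutation.permutation reflect reflect reflect² reflect²) ⟨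
      NatSum.sum (λ i → if does (member? (to i)) then 1 else 0)
        ≡⟨ count-tabulate member? to ⟨
      Vec.count member? (Vec.tabulate to) ∎
      where
      open ≡.≡-Reasoning
      open ConnectionSet D
      open import Algebra.Properties.AbelianGroup (CommutativeRing.+-abelianGroup commutativeRing) using (⁻¹-anti-homo‿-; xyx⁻¹≈y)
      reflect : Fin q → Fin q
      reflect i = from (x - to i)
      x-[x-y]≈y : ∀ y → x - (x - y) ≈ y
      x-[x-y]≈y y = trans (+-congˡ (⁻¹-anti-homo‿- x y)) (trans (sym (+-assoc x y (- x))) (xyx⁻¹≈y x y))
      reflect² : ∀ i → reflect (reflect i) ≡ i
      reflect² i = ≡.trans (from-cong (trans (+-congˡ (-‿cong (strictlyInverseˡ _))) (x-[x-y]≈y (to i)))) (strictlyInverseʳ i)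

open import Defs
open import Algebra.Apartness.Bundles using (HeytingField)
open import Data.Integer.Base using (-1ℤ)
open import Data.Nat.Base using (ℕ; _+_; _*_; _∸_; _^_; _≤_; NonZero)
open import Data.Nat.Divisibility using (_∣_)
open import Data.Nat.GCD using (gcd)
open import Data.Nat.Primality using (Prime)
open import Data.Product.Base using (_×_)
open import Relation.Binary.PropositionalEquality using (_≡_)
open import Relation.Nullary.Negation using (¬_)
open import Data.List.Relation.Unary.Any as Any using ()
open import Data.Nat.Base using (suc; s≤s; z≤n; nonTrivial⇒n>1)
open import Data.Nat.Coprimality as Coprimality using (Coprime)
open import Data.Nat.Divisibility using (∣-refl; ∣⇒≤)
open import Data.Nat.Primality using (prime⇒nonZero; prime⇒nonTrivial)
open import Data.Nat.Properties using (m≤n*m; m+[n∸m]≡n; ≤-antisym; ≤-trans; *-comm)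
open import Data.Product.Base using (_,_)
open import Relation.Binary.PropositionalEquality using (refl; trans; subst)
open Arithmetic
open FiniteFieldGraphs

theorem3p2 : ∀ {c ℓ₁ ℓ₂ k ℓ₃ ℓ₄}
    (p₁ m N p f q w : ℕ) .{{_ : NonZero N}} →
    Prime p₁ → ¬ (2 ∣ p₁) → 1 ≤ m → N ≡ p₁ ^ m →
    Prime p → gcd (p * (p ∸ 1)) N ≡ 1 →
    IsOrder p N f → q ≡ p ^ f → w * f ≡ φ N →
    ¬ (-1ℤ ∈⟨ p ⟩[mod N ]) →
    w ∣ (p₁ ∸ 1) →
    (F : HeytingField c ℓ₁ ℓ₂) (enum : Enumeration q (HeytingField.setoid F)) →
    (γ : HeytingField.Carrier F) (γ-primitive : IsPrimitive F γ) →
    let D = cyclotomicUnion F enum γ γ-primitive N (p₁ ^ (m ∸ 1))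
        G = Cay F enum D
    in
    Undirected G ×
    Regular G (cardinality enum (ConnectionSet.member? D)) ×
    ((K : HeytingField k ℓ₃ ℓ₄) → CharacteristicZero K →
      AtMost K (w + 1) (RestrictedEigenvalue K G))
-- With m = j + 1 the number of classes p₁^(m - 1) becomes `M`, and N = p₁ M.
theorem3p2 p₁ (suc j) N p f q w p₁-prime 2∤p₁ (s≤s _) refl p-prime _ ord q≡p^f w*f≡φ _ w∣p₁-1 F enum γ γ-primitive =
  undirected N M N∣q-1 M≤N N-odd , regular (D N M N∣q-1 M≤N) , λ K K-char0 n θ θ-injective restricted →
    ≤-trans (restrictedEigenvalues N M N∣q-1 M≤N p f p-prime q≡p^f p₁ (*-comm M p₁) (Coprimality.sym p-coprime-N)
      shift-power reps (λ b → Any.map (λ (mk~ e eq) → e , eq) (reps-cover b)) K K-char0 n θ θ-injective restricted)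
      length-reps
  where
  instance
    p₁≢0 : NonZero p₁
    p₁≢0 = prime⇒nonZero p₁-prime
  open OnFin F enum γ γ-primitive
  open FiniteFieldProperties finiteField
  open CosetArithmetic p₁ p₁-prime j p f w ord w*f≡φ w∣p₁-1
    using (M; M≢0;  p-coprime-N; shift-power; mk~; reps; reps-cover; length-reps)

  M≤N : M ≤ N
  M≤N = m≤n*m M p₁

  N∣q-1 : N ∣ q ∸ 1
  N∣q-1 = ≅-+⇒∣ 1 (≅-trans (≡⇒≅ (trans (m+[n∸m]≡n (1≤q 1≤q-1)) q≡p^f)) (order-power ord))
    where
    1≤q : ∀ {n} → 1 ≤ n ∸ 1 → 1 ≤ n
    1≤q {suc n} _ = s≤s z≤n

  p₁∤2 : ¬ (p₁ ∣ 2)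
  p₁∤2 p₁∣2 = 2∤p₁ (subst (2 ∣_) (≤-antisym (nonTrivial⇒n>1 p₁ {{prime⇒nonTrivial p₁-prime}}) (∣⇒≤ p₁∣2)) ∣-refl)

  N-odd : Coprime N 2
  N-odd = Coprimality.sym (∤⇒coprime-^ p₁-prime (suc j) p₁∤2)
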